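{- There exist two algorithms $\mathcal{A}$ and $\mathcal{B}$ with the following properties. For every computable function $f:\mathbb{N}\to\mathbb{N}$ (given to the algorithms by a description, e.g. a Turing machine computing $f$), the algorithm $\mathcal{A}$ on input $f$ returns a positive integer $w(f)$, and for every integer $n\geq w(f)$ the algorithm $\mathcal{B}$ on input $f$ and $n$ halts and returns a system $S\subseteq E_n$ such that $S$ is consistent over $\mathbb{N}$ (i.e. some $(x_1,\ldots,x_n)\in\mathbb{N}^n$ satisfies all equations of $S$) and every tuple $(x_1,\ldots,x_n)\in\mathbb{N}^n$ of non-negative integers that solves $S$ satisfies $x_1=f(n)$.
   Context: For a positive integer $n$, $E_n$ denotes the finite set of equations in the variables $x_1,\ldots,x_n$ $$E_n=\{x_i=1,\ x_i+x_j=x_k,\ x_i\cdot x_j=x_k:\ i,j,k\in\{1,\ldots,n\}\}.$$ A system $S\subseteq E_n$ is a finite set of such equations; a tuple $(x_1,\ldots,x_n)$ solves $S$ if it satisfies every equation in $S$. $\mathbb{N}=\{0,1,2,\ldots\}$. -}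

module Defs where

open import Data.Nat using (ℕ; zero; suc)
open import Data.Fin using (Fin)
open import Data.Vec using (Vec; []; _∷_; lookup)
open import Data.List using (List)
open import Data.List.Relation.Unary.All using (All)
open import Data.Maybe using (Maybe; just)
open import Data.Product using (Σ; ∃; _×_)
open import Relation.Binary.PropositionalEquality using (_≡_)
open import Data.Nat using (_+_; _*_)

-- Descriptions of computable functions: codes of μ-recursive functions
-- (a standard Turing-complete model), with big-step semantics.

data Code : ℕ → Set where
  Z : ∀ {k} → Code k
  Sc : Code 1
  P : ∀ {k} → Fin k → Code k
  C : ∀ {k m} → Code m → Vec (Code k) m → Code k
  R : ∀ {k} → Code k → Code (suc (suc k)) → Code (suc k)
  M : ∀ {k} → Code (suc k) → Code k

data Eval : ∀ {k} → Code k → Vec ℕ k → ℕ → Set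
data EvalAll : ∀ {k m} → Vec (Code k) m → Vec ℕ k → Vec ℕ m → Set
data MuFrom : ∀ {k} → Code (suc k) → Vec ℕ k → ℕ → ℕ → Set

data Eval where
  ev-Z : ∀ {k} {xs : Vec ℕ k} → Eval Z xs 0
  ev-S : ∀ {x} → Eval Sc (x ∷ []) (suc x)
  ev-P : ∀ {k} {i : Fin k} {xs} → Eval (P i) xs (lookup xs i)
  ev-C : ∀ {k m} {g : Code m} {hs : Vec (Code k) m} {xs ys y} →
         EvalAll hs xs ys → Eval g ys y → Eval (C g hs) xs y
  ev-R0 : ∀ {k} {g : Code k} {h : Code (suc (suc k))} {xs y} →
          Eval g xs y → Eval (R g h) (0 ∷ xs) y
  ev-RS : ∀ {k} {g : Code k} {h : Code (suc (suc k))} {n xs r y} →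
          Eval (R g h) (n ∷ xs) r → Eval h (n ∷ r ∷ xs) y →
          Eval (R g h) (suc n ∷ xs) y
  ev-M : ∀ {k} {g : Code (suc k)} {xs r} → MuFrom g xs 0 r → Eval (M g) xs r

data EvalAll where
  ea-[] : ∀ {k} {xs : Vec ℕ k} → EvalAll [] xs []
  ea-∷  : ∀ {k m} {h : Code k} {hs : Vec (Code k) m} {xs y ys} →
          Eval h xs y → EvalAll hs xs ys → EvalAll (h ∷ hs) xs (y ∷ ys)

data MuFrom where
  mu-stop : ∀ {k} {g : Code (suc k)} {xs i} →
            Eval g (i ∷ xs) 0 → MuFrom g xs i i
  mu-step : ∀ {k} {g : Code (suc k)} {xs i v r} →
            Eval g (i ∷ xs) (suc v) → MuFrom g xs (suc i) r → MuFrom g xs i r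

Computes : Code 1 → (ℕ → ℕ) → Set
Computes c f = ∀ n → Eval c (n ∷ []) (f n)

-- Algorithms are modelled as Agda functions with an extra fuel argument
-- (step bound): run k = nothing means "not halted within k steps".
-- Returns run x : the algorithm halts, and every output it ever produces is x.

Returns : ∀ {A : Set} → (ℕ → Maybe A) → A → Set
Returns run x = (∃ λ k → run k ≡ just x) × (∀ k y → run k ≡ just y → y ≡ x)

-- The equations E_n and systems S ⊆ E_n (variables x_1..x_n ↦ Fin n,
-- x_1 ↦ Fin.zero).

data Equation (n : ℕ) : Set where
  one : Fin n → Equation n
  add : Fin n → Fin n → Fin n → Equation n
  mul : Fin n → Fin n → Fin n → Equation n

System : ℕ → Set
System n = List (Equation n)

Sat : ∀ {n} → (Fin n → ℕ) → Equation n → Set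
Sat x (one i)     = x i ≡ 1
Sat x (add i j k) = x i + x j ≡ x k
Sat x (mul i j k) = x i * x j ≡ x k

Solves : ∀ {n} → (Fin n → ℕ) → System n → Set
Solves x S = All (Sat x) S

Consistent : ∀ {n} → System n → Set
Consistent {n} S = Σ (Fin n → ℕ) λ x → Solves x S

{-# OPTIONS --safe #-}
module Submission where

-- This is the Davis–Putnam–Robinson–Matiyasevich theorem for μ-recursive codes.  The graph of Eval c
-- is shown to be Diophantine by induction on c; flattening its definition gives a system in q
-- variables, q depending on c only, that forces x₁ = f(x₂).  For n ≥ 2q the remaining n − q ≥ q
-- variables are made to count 1, 2, 3, …, so that one more equation forces x₂ = (n − q) + q.
--
-- Exponentiation comes from the Pell equation (Matiyasevich), and with it digits in base 1 + q, binomial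
-- coefficients (digits of (2 + q)ⁿ) and factorials (quotients rⁿ / (r choose n) for large r).
-- Primitive recursion and minimisation then need one bounded universal quantifier.  With T = B! for
-- a large B and c = T² − 1, the binomial coefficient (c choose n) is the product of the pairwise
-- coprime numbers (c − i) / (i + 1), i < n, all of whose prime factors exceed B.  So by the Chinese
-- remainder theorem solutions for all i < n can be packed into one tuple solving the same
-- equations modulo (c choose n), which reduces to i modulo any prime factor of (c − i) / (i + 1).

open import Defs
open import Data.Nat using (ℕ; zero; suc; pred; _!; _+_; _*_; _∸_; _^_; _≤_; _<_; z≤n; s≤s; _≤?_; _<?_; >-nonZero; ≢-nonZero⁻¹; nonTrivial⇒n>1)
open import Data.Nat.Properties
open import Data.Nat.Divisibility
open import Data.Nat.DivMod using (_%_; _/_; m≡m%n+[m/n]*n; m/n*n≡m; m%n<n)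
open import Data.Nat.Induction using (<-wellFounded)
open import Data.Nat.Coprimality using (Coprime; coprime-Bézout; coprime-divisor) renaming (sym to coprime-sym)
open import Data.Nat.GCD using (module Bézout)
open import Data.Nat.ListAction using (product)
open import Data.Nat.Primality using (Prime; euclidsLemma; prime⇒nonTrivial)
open import Data.Nat.Primality.Factorisation using (factorise; module PrimeFactorisation)
open import Data.Nat.Tactic.RingSolver using (solve-∀)
open import Data.Fin using (Fin; zero; suc; toℕ; fromℕ; fromℕ<; inject₁; splitAt; _↑ˡ_; _↑ʳ_)
open import Data.Fin.Properties using (toℕ<n; toℕ-fromℕ; toℕ-fromℕ<; fromℕ<-toℕ; toℕ-injective; toℕ-inject₁; toℕ-↑ˡ; splitAt-↑ˡ; splitAt-↑ʳ)
open import Data.Fin.Induction using (<-weakInduction)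
open import Data.Vec using (Vec; []; _∷_; lookup; map; tabulate; take; drop; tail) renaming (_++_ to _⧺_)
open import Data.Vec.Properties using (lookup-map; map-cong; map-∘; take++drop≡id; lookup-++ˡ; lookup-++ʳ; lookup∘tabulate; tabulate∘lookup; tabulate-cong; tabulate-∘)
import Data.Vec.Relation.Unary.All as VAll
open import Data.Vec.Relation.Unary.All.Properties using (lookup⁺; lookup⁻)
open import Data.List using (List; []; _∷_; _++_) renaming (map to mapList; tabulate to tabulateList)
open import Data.List.Relation.Unary.All using (All; []; _∷_) renaming (map to mapAll; head to headAll; tail to tailAll)
open import Data.List.Relation.Unary.All.Properties using (++⁺; ++⁻ˡ; ++⁻ʳ; map⁺; map⁻; tabulate⁺; tabulate⁻)
open import Data.Maybe using (Maybe; just)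
open import Data.Product using (Σ; ∃; _×_; _,_; proj₁; proj₂)
open import Data.Sum using (_⊎_; inj₁; inj₂; [_,_]′)
open import Data.Unit using (⊤; tt)
open import Function using (_∘_)
open import Induction.WellFounded using (Acc; acc)
open import Relation.Nullary using (yes; no; contradiction)
open import Relation.Binary.Definitions using (tri<; tri≈; tri>)
open import Relation.Binary.PropositionalEquality

-- The bounded quantifier is the obstacle. It must become an existential statement whose number of
-- unknowns is independent of the bound, so the solutions for all i share one modulus, and that
-- modulus must be definable without any bounded product. A binomial coefficient meets both demands,
-- since powers alone suffice to define it. A solution modulo a prime p is a solution in ℕ once its
-- entries are at most some u with u, 2u and u² below p; hence the large B. That the entries are
-- small is again a divisibility: if p divides (a choose u + 1), then a has a residue at most u
-- modulo p. The quantifier is eliminated from a finite system and not from a formula, so its body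
-- is flattened first; then only 1, sums and products have to be transferred between ℕ and residues.
-- The two procedures never run c: the system is read off its syntax. The existence of the value
-- f(n) makes the system consistent, and determinism of evaluation makes x₁ equal to it.

-- Congruences and Chinese remaindering in ℕ

infix 4 _≋_[_]

-- A multiple of the modulus on each side replaces subtraction; symmetry is immediate, and the
-- definition is already an existential polynomial equation.
_≋_[_] : ℕ → ℕ → ℕ → Set
a ≋ b [ m ] = ∃ λ s → ∃ λ t → a + s * m ≡ b + t * m

≋-refl : ∀ {m a} → a ≋ a [ m ]
≋-refl = 0 , 0 , refl

≋-reflexive : ∀ {m a b} → a ≡ b → a ≋ b [ m ]
≋-reflexive refl = ≋-refl

≋-sym : ∀ {m a b} → a ≋ b [ m ] → b ≋ a [ m ]
≋-sym (s , t , e) = t , s , sym e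

≋-trans : ∀ {m a b c} → a ≋ b [ m ] → b ≋ c [ m ] → a ≋ c [ m ]
≋-trans {m} {a} {b} {c} (s , t , e) (s′ , t′ , e′) = s + s′ , t + t′ , (begin
  a + (s + s′) * m     ≡⟨ lemma₁ a s s′ m ⟩
  (a + s * m) + s′ * m ≡⟨ cong (_+ s′ * m) e ⟩
  (b + t * m) + s′ * m ≡⟨ lemma₂ b t s′ m ⟩
  (b + s′ * m) + t * m ≡⟨ cong (_+ t * m) e′ ⟩
  (c + t′ * m) + t * m ≡⟨ lemma₃ c t′ t m ⟩
  c + (t + t′) * m     ∎)
  where
  open ≡-Reasoning
  lemma₁ : ∀ a s s′ m → a + (s + s′) * m ≡ (a + s * m) + s′ * m
  lemma₁ = solve-∀
  lemma₂ : ∀ b t s′ m → (b + t * m) + s′ * m ≡ (b + s′ * m) + t * m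
  lemma₂ = solve-∀
  lemma₃ : ∀ c t′ t m → (c + t′ * m) + t * m ≡ c + (t + t′) * m
  lemma₃ = solve-∀

≋-+ : ∀ {m a b c d} → a ≋ b [ m ] → c ≋ d [ m ] → a + c ≋ b + d [ m ]
≋-+ {m} {a} {b} {c} {d} (s , t , e) (s′ , t′ , e′) = s + s′ , t + t′ ,
  trans (lemma a c s s′ m) (trans (cong₂ _+_ e e′) (sym (lemma b d t t′ m)))
  where
  lemma : ∀ a c s s′ m → a + c + (s + s′) * m ≡ (a + s * m) + (c + s′ * m)
  lemma = solve-∀

≋-* : ∀ {m a b c d} → a ≋ b [ m ] → c ≋ d [ m ] → a * c ≋ b * d [ m ]
≋-* {m} {a} {b} {c} {d} (s , t , e) (s′ , t′ , e′) =
  s * c + a * s′ + s * s′ * m , t * d + b * t′ + t * t′ * m ,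
  trans (lemma a c s s′ m) (trans (cong₂ _*_ e e′) (sym (lemma b d t t′ m)))
  where
  lemma : ∀ a c s s′ m → a * c + (s * c + a * s′ + s * s′ * m) * m ≡ (a + s * m) * (c + s′ * m)
  lemma = solve-∀

≋-+-cancelʳ : ∀ {m a b} c → a + c ≋ b + c [ m ] → a ≋ b [ m ]
≋-+-cancelʳ {m} {a} {b} c (s , t , e) = s , t ,
  +-cancelʳ-≡ c _ _ (trans (lemma a s m c) (trans e (sym (lemma b t m c))))
  where
  lemma : ∀ a s m c → a + s * m + c ≡ a + c + s * m
  lemma = solve-∀

≋-∣ : ∀ {d m a b} → d ∣ m → a ≋ b [ m ] → a ≋ b [ d ]
≋-∣ {d} {a = a} {b} (divides q refl) (s , t , e) = s * q , t * q ,
  trans (cong (a +_) (*-assoc s q d)) (trans e (cong (b +_) (sym (*-assoc t q d))))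

∣⇒≋0 : ∀ {m a} → m ∣ a → a ≋ 0 [ m ]
∣⇒≋0 (divides q refl) = 0 , q , +-identityʳ _

≋0⇒∣ : ∀ {m a} → a ≋ 0 [ m ] → m ∣ a
≋0⇒∣ {m} {a} (s , t , e) =
  ∣m+n∣m⇒∣n {m = s * m} (divides t (trans (+-comm (s * m) a) e)) (n∣m*n s)

≋-pres-∣ : ∀ {m a b} → a ≋ b [ m ] → m ∣ a → m ∣ b
≋-pres-∣ e d = ≋0⇒∣ (≋-trans (≋-sym e) (∣⇒≋0 d))

*m≋0 : ∀ {m} a → a * m ≋ 0 [ m ]
*m≋0 {m} a = 0 , a , +-identityʳ _

+*m≋ : ∀ {m} a k → a + k * m ≋ a [ m ]
+*m≋ {m} a k = 0 , k , +-identityʳ _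

≋⇒∣∸ : ∀ {m a} k → a + k ≋ a [ m ] → m ∣ k
≋⇒∣∸ {m} {a} k e = ≋0⇒∣ (≋-+-cancelʳ a (≋-trans (≋-reflexive (+-comm k a)) e))

private
  ≤-≋⇒≡ : ∀ {m a b} → a ≤ b → b < m → a ≋ b [ m ] → a ≡ b
  ≤-≋⇒≡ {m} {a} a≤b b<m e with m≤n⇒∃[o]m+o≡n a≤b
  ... | zero , refl = sym (+-identityʳ a)
  ... | suc k , refl = contradiction (≋⇒∣∸ (suc k) (≋-sym e))
                         (>⇒∤ (≤-<-trans (m≤n+m (suc k) a) b<m))

≋⇒≡ : ∀ {m a b} → a < m → b < m → a ≋ b [ m ] → a ≡ b
≋⇒≡ {m} {a} {b} a<m b<m e with ≤-total a b
... | inj₁ a≤b = ≤-≋⇒≡ a≤b b<m e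
... | inj₂ b≤a = sym (≤-≋⇒≡ b≤a a<m (≋-sym e))

∣-≋ : ∀ {m a b} → b ≤ a → m ∣ a ∸ b → a ≋ b [ m ]
∣-≋ {m} {a} {b} b≤a (divides q e) = 0 , q ,
  trans (+-identityʳ a) (trans (sym (m+[n∸m]≡n b≤a)) (cong (b +_) e))

coprime-inverse : ∀ {m n} → Coprime m n → ∃ λ x → x * m ≋ 1 [ n ]
coprime-inverse {m} {n} c with coprime-Bézout c
... | Bézout.+- x y eq = x , 0 , y , trans (+-identityʳ _) (sym eq)
-- Here 1 + x m = y n, so x m is -1 modulo n; its square is 1, which makes x x m an inverse.
... | Bézout.-+ x y eq = x * x * m , 2 * y , y * n * y , (begin
  x * x * m * m + 2 * y * n           ≡⟨ lemma₁ x m y n ⟩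
  (x * m) * (x * m) + 2 * (y * n)     ≡⟨ cong (λ z → (x * m) * (x * m) + 2 * z) (sym eq) ⟩
  (x * m) * (x * m) + 2 * (1 + x * m) ≡⟨ lemma₂ (x * m) ⟩
  1 + (1 + x * m) * (1 + x * m)       ≡⟨ cong (λ z → 1 + z * z) eq ⟩
  1 + (y * n) * (y * n)               ≡⟨ lemma₃ y n ⟩
  1 + y * n * y * n                   ∎)
  where
  open ≡-Reasoning
  lemma₁ : ∀ x m y n → x * x * m * m + 2 * y * n ≡ (x * m) * (x * m) + 2 * (y * n)
  lemma₁ = solve-∀
  lemma₂ : ∀ k → k * k + 2 * (1 + k) ≡ 1 + (1 + k) * (1 + k)
  lemma₂ = solve-∀
  lemma₃ : ∀ y n → 1 + (y * n) * (y * n) ≡ 1 + y * n * y * n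
  lemma₃ = solve-∀

coprime-CRT : ∀ {m n} → Coprime m n → ∀ a b → ∃ λ x → x ≋ a [ m ] × x ≋ b [ n ]
coprime-CRT {m} {n} c a b with coprime-inverse c | coprime-inverse (coprime-sym c)
... | i , im≋1 | j , jn≋1 = a * (j * n) + b * (i * m) ,
  ≋-trans (≋-+ (≋-* (≋-refl {a = a}) jn≋1) (≋-* (≋-refl {a = b}) (*m≋0 i)))
          (≋-reflexive (lemma a b)) ,
  ≋-trans (≋-+ (≋-* (≋-refl {a = a}) (*m≋0 j)) (≋-* (≋-refl {a = b}) im≋1))
          (≋-reflexive (lemma′ a b))
  where
  lemma : ∀ a b → a * 1 + b * 0 ≡ a
  lemma = solve-∀
  lemma′ : ∀ a b → a * 0 + b * 1 ≡ b
  lemma′ = solve-∀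

coprime-*ˡ : ∀ {a b c} → Coprime a c → Coprime b c → Coprime (a * b) c
coprime-*ˡ ca cb (d∣ab , d∣c) =
  cb (coprime-divisor (λ (e∣d , e∣a) → ca (e∣a , ∣-trans e∣d d∣c)) d∣ab , d∣c)

coprime-*-∣ : ∀ {m n z} → Coprime m n → m ∣ z → n ∣ z → m * n ∣ z
coprime-*-∣ {m} {n} c m∣z (divides q refl) =
  *-monoˡ-∣ n (coprime-divisor c (subst (m ∣_) (*-comm q n) m∣z))

prod : (ℕ → ℕ) → ℕ → ℕ
prod ms zero = 1
prod ms (suc n) = prod ms n * ms n

∣prod : ∀ ms {i n} → i < n → ms i ∣ prod ms n
∣prod ms {n = suc n} i<1+n with m<1+n⇒m<n∨m≡n i<1+n
... | inj₁ i<n = ∣m⇒∣m*n (ms n) (∣prod ms i<n)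
... | inj₂ refl = n∣m*n (prod ms n)

PairwiseCoprime : (ℕ → ℕ) → ℕ → Set
PairwiseCoprime ms n = ∀ {i j} → i < j → j < n → Coprime (ms i) (ms j)

prod-coprime : ∀ ms n {m} → (∀ {i} → i < n → Coprime (ms i) m) → Coprime (prod ms n) m
prod-coprime ms zero c (d∣1 , _) = ∣1⇒≡1 d∣1
prod-coprime ms (suc n) c =
  coprime-*ˡ (prod-coprime ms n (λ i<n → c (m<n⇒m<1+n i<n))) (c (n<1+n n))

prod-∣ : ∀ ms n {z} → PairwiseCoprime ms n → (∀ {i} → i < n → ms i ∣ z) → prod ms n ∣ z
prod-∣ ms zero c d = 1∣ _
prod-∣ ms (suc n) c d =
  coprime-*-∣ (prod-coprime ms n (λ i<n → c i<n (n<1+n n)))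
    (prod-∣ ms n (λ i<j j<n → c i<j (m<n⇒m<1+n j<n)) (λ i<n → d (m<n⇒m<1+n i<n)))
    (d (n<1+n n))

CRT : ∀ ms n → PairwiseCoprime ms n → (r : ℕ → ℕ) → ∃ λ a → ∀ {i} → i < n → a ≋ r i [ ms i ]
CRT ms zero c r = 0 , λ ()
CRT ms (suc n) c r = extend (CRT ms n (λ i<j j<n → c i<j (m<n⇒m<1+n j<n)) r)
  where
  Solution : ℕ → Set
  Solution n = ∃ λ a → ∀ {i} → i < n → a ≋ r i [ ms i ]
  helper : ∀ {a b} → (∀ {i} → i < n → a ≋ r i [ ms i ]) →
           b ≋ a [ prod ms n ] → b ≋ r n [ ms n ] → ∀ {i} → i < suc n → b ≋ r i [ ms i ]
  helper a≋ b≋a b≋rn i<1+n with m<1+n⇒m<n∨m≡n i<1+n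
  ... | inj₁ i<n = ≋-trans (≋-∣ (∣prod ms i<n) b≋a) (a≋ i<n)
  ... | inj₂ refl = b≋rn
  extend : Solution n → Solution (suc n)
  extend (a , a≋) =
    let b , b≋a , b≋rn = coprime-CRT (prod-coprime ms n (λ i<n → c i<n (n<1+n n))) a (r n)
    in b , helper a≋ b≋a b≋rn

-- Diophantine relations and their translation into systems

infixl 6 _⊕_
infixl 7 _⊗_

data Tm (k : ℕ) : Set where
  var     : Fin k → Tm k
  𝟘 𝟙     : Tm k
  _⊕_ _⊗_ : Tm k → Tm k → Tm k

⟦_⟧ : ∀ {k} → Tm k → Vec ℕ k → ℕ
⟦ var i ⟧ ν = lookup ν i
⟦ 𝟘 ⟧ ν = 0
⟦ 𝟙 ⟧ ν = 1
⟦ s ⊕ t ⟧ ν = ⟦ s ⟧ ν + ⟦ t ⟧ ν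
⟦ s ⊗ t ⟧ ν = ⟦ s ⟧ ν * ⟦ t ⟧ ν

infix  4 _≐_
infixr 3 _∧_

-- The index is the relation itself, so a formula and its meaning are built together. `call`
-- substitutes terms for variables, which lets a finished formula be reused anywhere; `iff` changes
-- only the description of the relation, never the equations generated.
data Dio : ∀ {k} → (Vec ℕ k → Set) → Set₁ where
  _≐_  : ∀ {k} (s t : Tm k) → Dio (λ ν → ⟦ s ⟧ ν ≡ ⟦ t ⟧ ν)
  _∧_  : ∀ {k} {R S : Vec ℕ k → Set} → Dio R → Dio S → Dio (λ ν → R ν × S ν)
  ex   : ∀ {k} {R : Vec ℕ (suc k) → Set} → Dio R → Dio (λ ν → ∃ λ x → R (x ∷ ν))
  call : ∀ {k m} {R : Vec ℕ m → Set} → Dio R → (ts : Vec (Tm k) m) →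
         Dio (λ ν → R (map (λ t → ⟦ t ⟧ ν) ts))
  iff  : ∀ {k} {R S : Vec ℕ k → Set} →
         (∀ ν → R ν → S ν) → (∀ ν → S ν → R ν) → Dio R → Dio S

-- Flattening

-- Unknowns are plain numbers and assignments are total, so fresh unknowns leave earlier equations
-- unchanged; finiteness is recorded by `Below`.
Env : Set
Env = ℕ → ℕ

data Eqn : Set where
  :one : ℕ → Eqn
  :add :mul : ℕ → ℕ → ℕ → Eqn

Holds : Env → Eqn → Set
Holds e (:one i) = e i ≡ 1
Holds e (:add i j k) = e i + e j ≡ e k
Holds e (:mul i j k) = e i * e j ≡ e k

Below : ℕ → Eqn → Set
Below s (:one i) = i < s
Below s (:add i j k) = i < s × j < s × k < s
Below s (:mul i j k) = i < s × j < s × k < s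

Agree : ℕ → Env → Env → Set
Agree s e e′ = ∀ {i} → i < s → e′ i ≡ e i

Below-≤ : ∀ {s s′} → s ≤ s′ → ∀ {q} → Below s q → Below s′ q
Below-≤ h {:one i} a = ≤-trans a h
Below-≤ h {:add i j k} (a , b , c) = ≤-trans a h , ≤-trans b h , ≤-trans c h
Below-≤ h {:mul i j k} (a , b , c) = ≤-trans a h , ≤-trans b h , ≤-trans c h

Holds-agree : ∀ {s e e′} → Agree s e e′ → ∀ {q} → Below s q → Holds e q → Holds e′ q
Holds-agree g {:one i} a h = trans (g a) h
Holds-agree g {:add i j k} (a , b , c) h = trans (cong₂ _+_ (g a) (g b)) (trans h (sym (g c)))
Holds-agree g {:mul i j k} (a , b , c) h = trans (cong₂ _*_ (g a) (g b)) (trans h (sym (g c)))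

AllHold-agree : ∀ {s e e′} → Agree s e e′ → ∀ {qs} → All (Below s) qs → All (Holds e) qs → All (Holds e′) qs
AllHold-agree g [] [] = []
AllHold-agree g (b ∷ bs) (h ∷ hs) = Holds-agree g b h ∷ AllHold-agree g bs hs

Agree-trans : ∀ {s s′ e e′ e″} → s ≤ s′ → Agree s e e′ → Agree s′ e′ e″ → Agree s e e″
Agree-trans h g g′ i<s = trans (g′ (≤-trans i<s h)) (g i<s)

map-agree : ∀ {k s e e′} {ρ : Vec ℕ k} → VAll.All (_< s) ρ → Agree s e e′ → map e′ ρ ≡ map e ρ
map-agree VAll.[] g = refl
map-agree (p VAll.∷ ps) g = cong₂ _∷_ (g p) (map-agree ps g)

update : Env → ℕ → ℕ → Env
update e s v i with i ≟ s
... | yes _ = v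
... | no  _ = e i

update-same : ∀ e s v → update e s v s ≡ v
update-same e s v with s ≟ s
... | yes _ = refl
... | no s≢s = contradiction refl s≢s

update-agree : ∀ e s v → Agree s e (update e s v)
update-agree e s v {i} i<s with i ≟ s
... | yes refl = contradiction i<s (<-irrefl refl)
... | no _ = refl

-- The names s, …, next − 1 are the auxiliary variables of eqs.
record Flat (s : ℕ) (Pre Post : Env → Set) : Set where
  field
    next     : ℕ
    s≤next   : s ≤ next
    eqs      : List Eqn
    below    : All (Below next) eqs
    sound    : ∀ e → All (Holds e) eqs → Post e
    complete : ∀ e → Pre e → ∃ λ e′ → Agree s e e′ × All (Holds e′) eqs

open Flat

nil : ∀ {s} {Pre Post : Env → Set} → (∀ e → Post e) → Flat s Pre Post
nil {s} post = record
  { next = s ; s≤next = ≤-refl ; eqs = [] ; below = []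
  ; sound = λ e _ → post e ; complete = λ e _ → e , (λ _ → refl) , [] }

-- The values assigned by `F` are known only through its soundness, so even completeness of the
-- composite uses `sound F`, to supply the precondition of `G`. Values chosen later for `G` do not
-- disturb `F`, whose equations mention only names below `next F`.
seq : ∀ {s} {A B C D Pre Post : Env → Set} (F : Flat s A B) → Flat (next F) C D →
      (∀ e → Pre e → A e) →
      (∀ e e′ → Agree s e e′ → Pre e → B e′ → C e′) →
      (∀ e → B e → D e → Post e) → Flat s Pre Post
seq {s} {Pre = Pre} F G a bc bd = record
  { next = next G ; s≤next = ≤-trans (s≤next F) (s≤next G) ; eqs = eqs F ++ eqs G
  ; below = ++⁺ (mapAll (λ {q} → Below-≤ (s≤next G) {q}) (below F)) (below G)
  ; sound = λ e h → bd e (sound F e (++⁻ˡ (eqs F) h)) (sound G e (++⁻ʳ (eqs F) h))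
  ; complete = compl }
  where
  compl : ∀ e → Pre e → ∃ λ e′ → Agree s e e′ × All (Holds e′) (eqs F ++ eqs G)
  compl e p =
    let e₁ , g₁ , h₁ = complete F e (a e p)
        e₂ , g₂ , h₂ = complete G e₁ (bc e e₁ g₁ p (sound F e₁ h₁))
    in e₂ , Agree-trans (s≤next F) g₁ g₂ , ++⁺ (AllHold-agree g₂ (below F) h₁) h₂

define : ∀ s (q : Eqn) → Below (suc s) q → {Post : Env → Set} (val : Env → ℕ) →
         (∀ e → Holds (update e s (val e)) q) →
         (∀ e → Holds e q → Post e) → Flat s (λ _ → ⊤) Post
define s q b val h post = record
  { next = suc s ; s≤next = n≤1+n s ; eqs = q ∷ [] ; below = b ∷ []
  ; sound = λ { e (x ∷ []) → post e x }
  ; complete = λ e _ → update e s (val e) , update-agree e s (val e) , h e ∷ [] }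

-- There is no equation for the constant 0, but x + x = x has 0 as its only solution.
flat-𝟘 : ∀ s → Flat s (λ _ → ⊤) (λ e → e s ≡ 0)
flat-𝟘 s = define s (:add s s s) (n<1+n s , n<1+n s , n<1+n s) (λ _ → 0)
  (λ e → let p = update-same e s 0 in trans (cong₂ _+_ p p) (sym p))
  (λ e p → m+n≡m⇒n≡0 (e s) p)
  where
  m+n≡m⇒n≡0 : ∀ m {n} → m + n ≡ m → n ≡ 0
  m+n≡m⇒n≡0 m p = +-cancelˡ-≡ m _ 0 (trans p (sym (+-identityʳ m)))

flat-𝟙 : ∀ s → Flat s (λ _ → ⊤) (λ e → e s ≡ 1)
flat-𝟙 s = define s (:one s) (n<1+n s) (λ _ → 1) (λ e → update-same e s 1) (λ e p → p)

flat-add : ∀ s {i j} → i < s → j < s → Flat s (λ _ → ⊤) (λ e → e s ≡ e i + e j)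
flat-add s {i} {j} i<s j<s =
  define s (:add i j s) (m<n⇒m<1+n i<s , m<n⇒m<1+n j<s , n<1+n s) (λ e → e i + e j)
    (λ e → let v = e i + e j in
      trans (cong₂ _+_ (update-agree e s v i<s) (update-agree e s v j<s)) (sym (update-same e s v)))
    (λ e p → sym p)

flat-mul : ∀ s {i j} → i < s → j < s → Flat s (λ _ → ⊤) (λ e → e s ≡ e i * e j)
flat-mul s {i} {j} i<s j<s =
  define s (:mul i j s) (m<n⇒m<1+n i<s , m<n⇒m<1+n j<s , n<1+n s) (λ e → e i * e j)
    (λ e → let v = e i * e j in
      trans (cong₂ _*_ (update-agree e s v i<s) (update-agree e s v j<s)) (sym (update-same e s v)))
    (λ e p → sym p)

flat-test : ∀ s (q : Eqn) → Below s q → Flat s (λ e → Holds e q) (λ e → Holds e q)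
flat-test s q b = record
  { next = s ; s≤next = ≤-refl ; eqs = q ∷ [] ; below = b ∷ []
  ; sound = λ { e (x ∷ []) → x } ; complete = λ e h → e , (λ _ → refl) , h ∷ [] }

-- Equality of two unknowns is not an admissible equation; it is expressed by adding a fresh zero.
flat-equal : ∀ s {i j} → i < s → j < s → Flat s (λ e → e i ≡ e j) (λ e → e i ≡ e j)
flat-equal s {i} {j} i<s j<s = seq (flat-𝟘 s)
  (flat-test (suc s) (:add i s j) (m<n⇒m<1+n i<s , n<1+n s , m<n⇒m<1+n j<s))
  (λ _ _ → tt)
  (λ e e′ g p z → trans (cong₂ _+_ (g i<s) z) (trans (+-identityʳ _) (trans p (sym (g j<s)))))
  (λ e z p → trans (sym (+-identityʳ _)) (trans (cong (e i +_) (sym z)) p))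

FlatTm : ∀ {k} → Tm k → Vec ℕ k → ℕ → Set
FlatTm t ρ s = Σ ℕ λ r → Σ (Flat s (λ _ → ⊤) (λ e → e r ≡ ⟦ t ⟧ (map e ρ))) λ F → r < next F

flatTm₂ : ∀ {k} {t u : Tm k} {ρ : Vec ℕ k} {s} (_∙_ : ℕ → ℕ → ℕ) →
          (∀ s {i j} → i < s → j < s → Σ (Flat s (λ _ → ⊤) (λ e → e s ≡ e i ∙ e j)) λ F → s < next F) →
          FlatTm t ρ s → (∀ s′ → s ≤ s′ → FlatTm u ρ s′) →
          Σ ℕ λ r → Σ (Flat s (λ _ → ⊤) (λ e → e r ≡ ⟦ t ⟧ (map e ρ) ∙ ⟦ u ⟧ (map e ρ))) λ F → r < next F
flatTm₂ _∙_ op (r₁ , F , r₁<) fu =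
  let r₂ , G , r₂< = fu (next F) (s≤next F)
      H , s< = op (next G) (≤-trans r₁< (s≤next G)) r₂<
  in next G ,
     seq F (seq G H (λ _ _ → tt) (λ _ _ _ _ _ → tt) (λ e p q → p , q))
         (λ _ _ → tt) (λ _ _ _ _ _ → tt) (λ { e p (q , r) → trans r (cong₂ _∙_ p q) }) ,
     s<

flatTm : ∀ {k} (t : Tm k) {ρ : Vec ℕ k} s → VAll.All (_< s) ρ → FlatTm t ρ s
flatTm (var i) {ρ} s ρ<s = lookup ρ i , nil (λ e → sym (lookup-map i e ρ)) , lookup⁺ ρ<s i
flatTm 𝟘 s ρ<s = s , flat-𝟘 s , n<1+n s
flatTm 𝟙 s ρ<s = s , flat-𝟙 s , n<1+n s
flatTm (t ⊕ u) {ρ} s ρ<s = flatTm₂ {t = t} {u} _+_ (λ s a b → flat-add s a b , n<1+n s) (flatTm t s ρ<s)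
  (λ s′ h → flatTm u s′ (VAll.map (λ p → ≤-trans p h) ρ<s))
flatTm (t ⊗ u) {ρ} s ρ<s = flatTm₂ {t = t} {u} _*_ (λ s a b → flat-mul s a b , n<1+n s) (flatTm t s ρ<s)
  (λ s′ h → flatTm u s′ (VAll.map (λ p → ≤-trans p h) ρ<s))

flatTms : ∀ {k m} (ts : Vec (Tm k) m) {ρ : Vec ℕ k} s → VAll.All (_< s) ρ →
          Σ (Vec ℕ m) λ rs →
          Σ (Flat s (λ _ → ⊤) (λ e → map e rs ≡ map (λ t → ⟦ t ⟧ (map e ρ)) ts)) λ F →
          VAll.All (_< next F) rs
flatTms [] s ρ<s = [] , nil (λ e → refl) , VAll.[]
flatTms (t ∷ ts) s ρ<s =
  let r , F , r< = flatTm t s ρ<s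
      rs , G , rs< = flatTms ts (next F) (VAll.map (λ p → ≤-trans p (s≤next F)) ρ<s)
  in r ∷ rs ,
     seq F G (λ _ _ → tt) (λ _ _ _ _ _ → tt) (λ e p q → cong₂ _∷_ p q) ,
     ≤-trans r< (s≤next G) VAll.∷ rs<

-- `ρ` assigns names to the variables of the formula, so the substitution in `call` is a mere change
-- of `ρ`, and `ex` prepends the fresh name `s`.
flatten : ∀ {k} {R : Vec ℕ k → Set} → Dio R → (ρ : Vec ℕ k) (s : ℕ) → VAll.All (_< s) ρ →
          Flat s (λ e → R (map e ρ)) (λ e → R (map e ρ))
flatten (t ≐ u) ρ s ρ<s =
  let r₁ , F , r₁< = flatTm t s ρ<s
      r₂ , G , r₂< = flatTm u (next F) (VAll.map (λ p → ≤-trans p (s≤next F)) ρ<s)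
      H = flat-equal (next G) (≤-trans r₁< (s≤next G)) r₂<
      FG : Flat s (λ _ → ⊤) (λ e → e r₁ ≡ ⟦ t ⟧ (map e ρ) × e r₂ ≡ ⟦ u ⟧ (map e ρ))
      FG = seq F G (λ _ _ → tt) (λ _ _ _ _ _ → tt) (λ e p q → p , q)
  in seq FG H (λ _ _ → tt)
       (λ { e e′ g eq (p , q) → trans p (trans (cong ⟦ t ⟧ (map-agree ρ<s g)) (trans eq
              (trans (cong ⟦ u ⟧ (sym (map-agree ρ<s g))) (sym q)))) })
       (λ { e (p , q) r → trans (sym p) (trans r q) })
flatten (_∧_ {S = S} d d′) ρ s ρ<s =
  let F = flatten d ρ s ρ<s
      G = flatten d′ ρ (next F) (VAll.map (λ p → ≤-trans p (s≤next F)) ρ<s)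
  in seq F G (λ e → proj₁)
       (λ e e′ g p _ → subst S (sym (map-agree ρ<s g)) (proj₂ p))
       (λ e p q → p , q)
flatten (ex {R = Q} d) ρ s ρ<s = record
  { next = next F ; s≤next = ≤-trans (n≤1+n s) (s≤next F) ; eqs = eqs F ; below = below F
  ; sound = λ e h → e s , sound F e h
  ; complete = compl }
  where
  F = flatten d (s ∷ ρ) (suc s) (n<1+n s VAll.∷ VAll.map m<n⇒m<1+n ρ<s)
  compl : ∀ e → ∃ (λ x → Q (x ∷ map e ρ)) → ∃ λ e′ → Agree s e e′ × All (Holds e′) (eqs F)
  compl e (x , p) =
    let e₁ = update e s x
        e₂ , g , h = complete F e₁
          (subst Q (sym (cong₂ _∷_ (update-same e s x) (map-agree ρ<s (update-agree e s x)))) p)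
    in e₂ , Agree-trans (n≤1+n s) (update-agree e s x) g , h
flatten (call {R = Q} d ts) ρ s ρ<s =
  let rs , F , rs< = flatTms ts s ρ<s
      G = flatten d rs (next F) rs<
  in seq F G (λ _ _ → tt)
       (λ e e′ g p q → subst Q (sym (trans q (cong (λ ν → map (λ t → ⟦ t ⟧ ν) ts) (map-agree ρ<s g)))) p)
       (λ e q p → subst Q q p)
flatten (iff to from d) ρ s ρ<s = 
  let F = flatten d ρ s ρ<s in record
  { next = next F ; s≤next = s≤next F ; eqs = eqs F ; below = below F
  ; sound = λ e h → to _ (sound F e h) ; complete = λ e p → complete F e (from _ p) }

toEquation : ∀ {N} (q : Eqn) → Below N q → Equation N
toEquation (:one i) a = one (fromℕ< a)
toEquation (:add i j k) (a , b , c) = add (fromℕ< a) (fromℕ< b) (fromℕ< c)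
toEquation (:mul i j k) (a , b , c) = mul (fromℕ< a) (fromℕ< b) (fromℕ< c)

toSystem : ∀ {N qs} → All (Below N) qs → System N
toSystem [] = []
toSystem (_∷_ {q} b bs) = toEquation q b ∷ toSystem bs

extend : ∀ {N} → (Fin N → ℕ) → Env
extend {N} x i with i <? N
... | yes i<N = x (fromℕ< i<N)
... | no  _   = 0

extend-fromℕ< : ∀ {N} (x : Fin N → ℕ) {i} (i<N : i < N) → extend x i ≡ x (fromℕ< i<N)
extend-fromℕ< {N} x {i} i<N with i <? N
... | yes p = cong (λ p → x (fromℕ< p)) (≤-irrelevant p i<N)
... | no i≮N = contradiction i<N i≮N

Sat⇒Holds : ∀ {N} (x : Fin N → ℕ) e → (∀ {i} (a : i < N) → e i ≡ x (fromℕ< a)) →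
            ∀ q b → Sat x (toEquation q b) → Holds e q
Sat⇒Holds x e g (:one i) a h = trans (g a) h
Sat⇒Holds x e g (:add i j k) (a , b , c) h = trans (cong₂ _+_ (g a) (g b)) (trans h (sym (g c)))
Sat⇒Holds x e g (:mul i j k) (a , b , c) h = trans (cong₂ _*_ (g a) (g b)) (trans h (sym (g c)))

Holds⇒Sat : ∀ {N} e q (b : Below N q) → Holds e q → Sat (e ∘ toℕ) (toEquation q b)
Holds⇒Sat e (:one i) a h = trans (cong e (toℕ-fromℕ< a)) h
Holds⇒Sat e (:add i j k) (a , b , c) h
  rewrite toℕ-fromℕ< a | toℕ-fromℕ< b | toℕ-fromℕ< c = h
Holds⇒Sat e (:mul i j k) (a , b , c) h
  rewrite toℕ-fromℕ< a | toℕ-fromℕ< b | toℕ-fromℕ< c = h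

Solves⇒AllHold : ∀ {N} (x : Fin N → ℕ) {qs} (bs : All (Below N) qs) →
                 Solves x (toSystem bs) → All (Holds (extend x)) qs
Solves⇒AllHold x [] [] = []
Solves⇒AllHold x (_∷_ {q} b bs) (h ∷ hs) =
  Sat⇒Holds x (extend x) (extend-fromℕ< x) q b h ∷ Solves⇒AllHold x bs hs

AllHold⇒Solves : ∀ {N} e {qs} (bs : All (Below N) qs) →
                 All (Holds e) qs → Solves (e ∘ toℕ) (toSystem bs)
AllHold⇒Solves e [] [] = []
AllHold⇒Solves e (_∷_ {q} b bs) (h ∷ hs) = Holds⇒Sat e q b h ∷ AllHold⇒Solves e bs hs

-- All that the later stages need of a formula: the first k unknowns are its arguments, and the
-- number `aux` of further unknowns does not depend on their values.
record Normal {k} (R : Vec ℕ k → Set) : Set where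
  field
    aux       : ℕ
    system    : System (k + aux)
    solution⇒ : ∀ x → Solves x system → R (tabulate (λ i → x (i ↑ˡ aux)))
    ⇒solution : ∀ xs → R xs → ∃ λ x → (∀ i → x (i ↑ˡ aux) ≡ lookup xs i) × Solves x system

names : ∀ k → Vec ℕ k
names k = tabulate toℕ

names< : ∀ k → VAll.All (_< k) (names k)
names< k = lookup⁻ (λ i → subst (_< k) (sym (lookup∘tabulate toℕ i)) (toℕ<n i))

Flat⇒Normal : ∀ {k} {R : Vec ℕ k → Set} (Φ : Env → Set) →
              (∀ e → Φ e → R (tabulate (e ∘ toℕ))) → (∀ e → R (tabulate (e ∘ toℕ)) → Φ e) →
              Flat k Φ Φ → Normal R
Flat⇒Normal {k} {Q} Φ to from F with m≤n⇒∃[o]m+o≡n (s≤next F)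
... | m , k+m≡N = record
  { aux = m
  ; system = toSystem bs
  ; solution⇒ = λ x h → subst Q
      (tabulate-cong (λ i → trans (extend-fromℕ< x (k<N i))
        (cong x (fromℕ<-↑ˡ i (k<N i)))))
      (to _ (sound F (extend x) (Solves⇒AllHold x bs h)))
  ; ⇒solution = compl }
  where
  bs : All (Below (k + m)) (eqs F)
  bs = subst (λ N → All (Below N) (eqs F)) (sym k+m≡N) (below F)
  k<N : ∀ (i : Fin k) → toℕ i < k + m
  k<N i = ≤-trans (toℕ<n i) (m≤m+n k m)
  fromℕ<-↑ˡ : ∀ (i : Fin k) (p : toℕ i < k + m) → fromℕ< p ≡ i ↑ˡ m
  fromℕ<-↑ˡ i p = toℕ-injective (trans (toℕ-fromℕ< p) (sym (toℕ-↑ˡ i m)))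
  compl : ∀ xs → Q xs → ∃ λ x → (∀ i → x (i ↑ˡ m) ≡ lookup xs i) × Solves x (toSystem bs)
  compl xs r =
    let e = extend (lookup xs)
        e-toℕ : ∀ i → e (toℕ i) ≡ lookup xs i
        e-toℕ i = trans (extend-fromℕ< (lookup xs) (toℕ<n i)) (cong (lookup xs) (fromℕ<-toℕ i (toℕ<n i)))
        e′ , g , h = complete F e (from e (subst Q
          (sym (trans (tabulate-cong e-toℕ) (tabulate∘lookup xs))) r))
    in e′ ∘ toℕ ,
       (λ i → trans (cong e′ (toℕ-↑ˡ i m)) (trans (g (toℕ<n i)) (e-toℕ i))) ,
       AllHold⇒Solves e′ bs h

normalise : ∀ {k} {R : Vec ℕ k → Set} → Dio R → Normal R
normalise {k} {Q} d = Flat⇒Normal (λ e → Q (map e (names k)))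
  (λ e → subst Q (sym (tabulate-∘ e toℕ)))
  (λ e → subst Q (tabulate-∘ e toℕ))
  (flatten d (names k) k (names< k))

-- The Pell equation: X A n + Y A n √Δ = (a + √Δ)ⁿ for a = 1 + A and Δ = a² − 1 = A (A + 2).

Δ : ℕ → ℕ
Δ A = A * (2 + A)

X Y : ℕ → ℕ → ℕ
X A zero = 1
X A (suc n) = suc A * X A n + Δ A * Y A n
Y A zero = 0
Y A (suc n) = X A n + suc A * Y A n

Pell : ℕ → ℕ → ℕ → Set
Pell A x y = x * x ≡ 1 + Δ A * (y * y)

-- Multiplication by a + √Δ, which has norm 1, preserves the norm x² - Δ y²; negative terms are
-- moved to the other side.
pell-step : ∀ A x y → (suc A * x + Δ A * y) * (suc A * x + Δ A * y) + (1 + Δ A * (y * y))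
                    ≡ (1 + Δ A * ((x + suc A * y) * (x + suc A * y))) + x * x
pell-step = identity
  where
  identity : ∀ A x y → (suc A * x + A * (2 + A) * y) * (suc A * x + A * (2 + A) * y) + (1 + A * (2 + A) * (y * y))
                     ≡ (1 + A * (2 + A) * ((x + suc A * y) * (x + suc A * y))) + x * x
  identity = solve-∀

XY-Pell : ∀ A n → Pell A (X A n) (Y A n)
XY-Pell A zero = cong suc (sym (*-zeroʳ (Δ A)))
XY-Pell A (suc n) = +-cancelʳ-≡ (X A n * X A n) _ _
  (trans (cong (X A (suc n) * X A (suc n) +_) (XY-Pell A n)) (pell-step A (X A n) (Y A n)))

X-+ : ∀ A m n → X A (m + n) ≡ X A m * X A n + Δ A * (Y A m * Y A n)
Y-+ : ∀ A m n → Y A (m + n) ≡ X A m * Y A n + Y A m * X A n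
X-+ A zero n = identity (X A n) (Δ A)
  where
  identity : ∀ x d → x ≡ x + 0 + d * 0
  identity = solve-∀
X-+ A (suc m) n = trans (cong₂ (λ x y → suc A * x + Δ A * y) (X-+ A m n) (Y-+ A m n))
  (identity (suc A) (Δ A) (X A m) (Y A m) (X A n) (Y A n))
  where
  identity : ∀ a d x y z w → a * (x * z + d * (y * w)) + d * (x * w + y * z)
                           ≡ (a * x + d * y) * z + d * ((x + a * y) * w)
  identity = solve-∀
Y-+ A zero n = sym (trans (+-identityʳ _) (+-identityʳ _))
Y-+ A (suc m) n = trans (cong₂ (λ x y → x + suc A * y) (X-+ A m n) (Y-+ A m n))
  (identity (suc A) (Δ A) (X A m) (Y A m) (X A n) (Y A n))
  where
  identity : ∀ a d x y z w → (x * z + d * (y * w)) + a * (x * w + y * z)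
                           ≡ (a * x + d * y) * w + (x + a * y) * z
  identity = solve-∀

-- The analogue of cosh(s + t) + cosh(s - t) = 2 cosh s cosh t. Modulo X_n it says that X changes
-- sign when its index is shifted by 2n (take e = n) or reflected about n (take m + e = n).
X-reflect : ∀ A m e → X A (m + e + e) + X A m ≡ 2 * X A e * X A (m + e)
X-reflect A m e = begin
  X A (m + e + e) + xm                             ≡⟨ cong (_+ xm) (X-+ A (m + e) e) ⟩
  X A (m + e) * xe + d * (Y A (m + e) * ye) + xm   ≡⟨ cong₂ (λ p q → p * xe + d * (q * ye) + xm) (X-+ A m e) (Y-+ A m e) ⟩
  p * xe + d * ((xm * ye + ym * xe) * ye) + xm     ≡⟨ lemma₁ p d xm ym xe ye ⟩
  p * xe + (xm * (1 + d * (ye * ye)) + d * (ym * ye) * xe)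
                                                   ≡⟨ cong (λ z → p * xe + (xm * z + d * (ym * ye) * xe)) (sym (XY-Pell A e)) ⟩
  p * xe + (xm * (xe * xe) + d * (ym * ye) * xe)   ≡⟨ lemma₂ d xm ym xe ye ⟩
  2 * xe * p                                       ≡⟨ cong (2 * xe *_) (sym (X-+ A m e)) ⟩
  2 * xe * X A (m + e)                             ∎
  where
  open ≡-Reasoning
  d = Δ A
  xm = X A m
  ym = Y A m
  xe = X A e
  ye = Y A e
  p = xm * xe + d * (ym * ye)
  lemma₁ : ∀ p d xm ym xe ye → p * xe + d * ((xm * ye + ym * xe) * ye) + xm
         ≡ p * xe + (xm * (1 + d * (ye * ye)) + d * (ym * ye) * xe)
  lemma₁ = solve-∀
  lemma₂ : ∀ d xm ym xe ye → (xm * xe + d * (ym * ye)) * xe + (xm * (xe * xe) + d * (ym * ye) * xe)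
         ≡ 2 * xe * (xm * xe + d * (ym * ye))
  lemma₂ = solve-∀

X>0 : ∀ A n → 0 < X A n
X>0 A zero = s≤s z≤n
X>0 A (suc n) = ≤-trans (X>0 A n) (≤-trans (m≤m+n _ _) (m≤m+n _ _))

Y-<-suc : ∀ A n → Y A n < Y A (suc n)
Y-<-suc A n = +-mono-≤ (X>0 A n) (m≤m+n (Y A n) _)

Y-mono-< : ∀ A {m n} → m < n → Y A m < Y A n
Y-mono-< A {n = suc n} m<1+n with m<1+n⇒m<n∨m≡n m<1+n
... | inj₁ m<n = <-trans (Y-mono-< A m<n) (Y-<-suc A n)
... | inj₂ refl = Y-<-suc A n

n≤Y : ∀ A n → n ≤ Y A n
n≤Y A zero = z≤n
n≤Y A (suc n) = ≤-<-trans (n≤Y A n) (Y-<-suc A n)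

Y>0 : ∀ A n → 0 < Y A (suc n)
Y>0 A n = ≤-trans (s≤s z≤n) (n≤Y A (suc n))

-- With a at least 3, two earlier terms always add up to less than X_n; this is what will tell X_r
-- from -X_r modulo X_n.
2X<X : ∀ {A} → 2 ≤ A → ∀ {m n} → m < n → 2 * X A m < X A n
2X<X {A} 2≤A {m} {suc n} m<1+n with m<1+n⇒m<n∨m≡n m<1+n
... | inj₁ m<n = <-≤-trans (2X<X 2≤A m<n) (≤-trans (m≤m+n (X A n) _) (m≤m+n _ _))
... | inj₂ refl = <-≤-trans (*-monoˡ-< (X A n) {{>-nonZero (X>0 A n)}} (s≤s 2≤A)) (m≤m+n (suc A * X A n) _)

X-mono-< : ∀ {A} → 2 ≤ A → ∀ {m n} → m < n → X A m < X A n
X-mono-< 2≤A m<n = ≤-<-trans (m≤m+n _ _) (2X<X 2≤A m<n)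

X-injective : ∀ {A} → 2 ≤ A → ∀ {m n} → X A m ≡ X A n → m ≡ n
X-injective 2≤A {m} {n} e with <-cmp m n
... | tri< m<n _ _ = contradiction e (<⇒≢ (X-mono-< 2≤A m<n))
... | tri≈ _ m≡n _ = m≡n
... | tri> _ _ n<m = contradiction (sym e) (<⇒≢ (X-mono-< 2≤A n<m))

square-cancel-≤ : ∀ {m n} → m * m ≤ n * n → m ≤ n
square-cancel-≤ {m} {n} h with m ≤? n
... | yes m≤n = m≤n
... | no m≰n = contradiction h (<⇒≱ (*-mono-< (≰⇒> m≰n) (≰⇒> m≰n)))

square-cancel-< : ∀ {m n} → m * m < n * n → m < n
square-cancel-< {m} {n} h with n ≤? m
... | yes n≤m = contradiction h (≤⇒≯ (*-mono-≤ n≤m n≤m))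
... | no n≰m = ≰⇒> n≰m

-- Multiplication by the inverse unit a - √Δ gives x₁ = a x - Δ y and y₁ = a y - x. The inequalities
-- make both subtractions exact, and A y < x makes y₁ smaller than y.
pell-descend : ∀ A x y → Pell A x (suc y) →
               ∃ λ x′ → ∃ λ y′ → y′ < suc y × x ≡ suc A * x′ + Δ A * y′ × suc y ≡ x′ + suc A * y′ × Pell A x′ y′
pell-descend A x y′ p =
  x₁ , y₁ , y₁<y , x≡ , y≡ , sym (+-cancelˡ-≡ (x * x) _ _
    (trans (cong (λ z → z * z + (1 + d * (y₁ * y₁))) x≡)
      (trans (pell-step A x₁ y₁)
        (cong (_+ x₁ * x₁) (trans (cong (λ z → 1 + d * (z * z)) (sym y≡)) (sym p))))))
  where
  y = suc y′
  a = suc A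
  d = Δ A
  a²≡1+d : a * a ≡ 1 + d
  a²≡1+d = identity A
    where
    identity : ∀ A → suc A * suc A ≡ 1 + A * (2 + A)
    identity = solve-∀
  [ay]²≡ : (a * y) * (a * y) ≡ y * y + d * (y * y)
  [ay]²≡ = trans (l a y) (trans (cong (_* (y * y)) a²≡1+d) (l′ d (y * y)))
    where
    l : ∀ a y → (a * y) * (a * y) ≡ a * a * (y * y)
    l = solve-∀
    l′ : ∀ d z → (1 + d) * z ≡ z + d * z
    l′ = solve-∀
  x≤ay : x ≤ a * y
  x≤ay = square-cancel-≤ (subst₂ _≤_ (sym p) (sym [ay]²≡) (+-monoˡ-≤ (d * (y * y)) (s≤s z≤n)))
  Ay<x : A * y < x
  Ay<x = square-cancel-< (subst₂ _<_ (l A y) (sym p)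
           (s≤s (*-monoˡ-≤ (y * y) (*-monoʳ-≤ A (m≤n+m A 2)))))
    where
    l : ∀ A y → A * A * (y * y) ≡ (A * y) * (A * y)
    l = solve-∀
  dy≤ax : d * y ≤ a * x
  dy≤ax = square-cancel-≤ (begin
    (d * y) * (d * y)         ≡⟨ l d y ⟩
    d * (d * (y * y))         ≤⟨ *-monoˡ-≤ (d * (y * y)) (n≤1+n d) ⟩
    (1 + d) * (d * (y * y))   ≤⟨ *-monoʳ-≤ (1 + d) (n≤1+n _) ⟩
    (1 + d) * (1 + d * (y * y)) ≡⟨ cong₂ _*_ (sym a²≡1+d) (sym p) ⟩
    a * a * (x * x)           ≡⟨ l′ a x ⟩
    (a * x) * (a * x)         ∎)
    where
    open ≤-Reasoning
    l : ∀ d y → (d * y) * (d * y) ≡ d * (d * (y * y))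
    l = solve-∀
    l′ : ∀ a x → a * a * (x * x) ≡ (a * x) * (a * x)
    l′ = solve-∀
  x₁ = a * x ∸ d * y
  y₁ = a * y ∸ x
  ax≡ : a * x ≡ d * y + x₁
  ax≡ = sym (m+[n∸m]≡n dy≤ax)
  ay≡ : a * y ≡ x + y₁
  ay≡ = sym (m+[n∸m]≡n x≤ay)
  y₁<y : y₁ < y
  y₁<y = +-cancelˡ-< x _ _ (subst₂ _<_ ay≡ (+-comm y x) (+-monoʳ-< y Ay<x))
  x≡ : x ≡ a * x₁ + d * y₁
  x≡ = +-cancelʳ-≡ (a * (d * y) + d * x) _ _ (begin
    x + (a * (d * y) + d * x)           ≡⟨ l₁ x a d y ⟩
    (1 + d) * x + d * (a * y)           ≡⟨ cong₂ (λ p q → p * x + d * q) (sym a²≡1+d) ay≡ ⟩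
    a * a * x + d * (x + y₁)            ≡⟨ cong (_+ d * (x + y₁)) (*-assoc a a x) ⟩
    a * (a * x) + d * (x + y₁)          ≡⟨ cong (λ z → a * z + d * (x + y₁)) ax≡ ⟩
    a * (d * y + x₁) + d * (x + y₁)     ≡⟨ l₂ a d x y x₁ y₁ ⟩
    a * x₁ + d * y₁ + (a * (d * y) + d * x) ∎)
    where
    open ≡-Reasoning
    l₁ : ∀ x a d y → x + (a * (d * y) + d * x) ≡ (1 + d) * x + d * (a * y)
    l₁ = solve-∀
    l₂ : ∀ a d x y x₁ y₁ → a * (d * y + x₁) + d * (x + y₁) ≡ a * x₁ + d * y₁ + (a * (d * y) + d * x)
    l₂ = solve-∀
  y≡ : y ≡ x₁ + a * y₁
  y≡ = +-cancelʳ-≡ (d * y + a * x) _ _ (begin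
    y + (d * y + a * x)         ≡⟨ l₁ y d a x ⟩
    (1 + d) * y + a * x         ≡⟨ cong₂ (λ p q → p * y + q) (sym a²≡1+d) ax≡ ⟩
    a * a * y + (d * y + x₁)    ≡⟨ cong (_+ (d * y + x₁)) (*-assoc a a y) ⟩
    a * (a * y) + (d * y + x₁)  ≡⟨ cong (λ z → a * z + (d * y + x₁)) ay≡ ⟩
    a * (x + y₁) + (d * y + x₁) ≡⟨ l₂ a d x y x₁ y₁ ⟩
    x₁ + a * y₁ + (d * y + a * x) ∎)
    where
    open ≡-Reasoning
    l₁ : ∀ y d a x → y + (d * y + a * x) ≡ (1 + d) * y + a * x
    l₁ = solve-∀
    l₂ : ∀ a d x y x₁ y₁ → a * (x + y₁) + (d * y + x₁) ≡ x₁ + a * y₁ + (d * y + a * x)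
    l₂ = solve-∀

pell-solutions : ∀ A x y → Pell A x y → ∃ λ n → x ≡ X A n × y ≡ Y A n
pell-solutions A x y p = go x y (<-wellFounded y) p
  where
  go : ∀ x y → Acc _<_ y → Pell A x y → ∃ λ n → x ≡ X A n × y ≡ Y A n
  go x zero _ p = 0 , m*n≡1⇒m≡1 x x (trans p (cong suc (*-zeroʳ (Δ A)))) , refl
  go x (suc y) (acc rec) p =
    let x′ , y′ , y′<y , x≡ , y≡ , p′ = pell-descend A x y p
        n , x′≡ , y′≡ = go x′ y′ (rec y′<y) p′
    in suc n , trans x≡ (cong₂ (λ x y → suc A * x + Δ A * y) x′≡ y′≡)
             , trans y≡ (cong₂ (λ x y → x + suc A * y) x′≡ y′≡)

-- Divisibility and congruence properties of the Pell sequences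

≋-*-scale : ∀ {m a b} c → a ≋ b [ m ] → c * a ≋ c * b [ c * m ]
≋-*-scale {m} {a} {b} c (s , t , e) = s , t ,
  trans (identity c a s m) (trans (cong (c *_) e) (sym (identity c b t m)))
  where
  identity : ∀ c a s m → c * a + s * (c * m) ≡ c * (a + s * m)
  identity = solve-∀

X≋1 : ∀ A n → X A n ≋ 1 [ A ]
X≋1 A zero = ≋-refl
X≋1 A (suc n) = ≋-trans (≋-reflexive (identity A (X A n) (Y A n)))
  (≋-trans (+*m≋ (X A n) (X A n + (2 + A) * Y A n)) (X≋1 A n))
  where
  identity : ∀ A x y → suc A * x + A * (2 + A) * y ≡ x + (x + (2 + A) * y) * A
  identity = solve-∀

-- Modulo A the base a is 1 and Δ is 0. This is how an index is read off from a Pell value.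
Y≋n : ∀ A n → Y A n ≋ n [ A ]
Y≋n A zero = ≋-refl
Y≋n A (suc n) = ≋-trans (≋-reflexive (identity A (X A n) (Y A n)))
  (≋-trans (+*m≋ (X A n + Y A n) (Y A n)) (≋-+ (X≋1 A n) (Y≋n A n)))
  where
  identity : ∀ A x y → x + suc A * y ≡ x + y + y * A
  identity = solve-∀

X-base : ∀ {A B u} → A ≋ B [ u ] → ∀ n → X A n ≋ X B n [ u ]
Y-base : ∀ {A B u} → A ≋ B [ u ] → ∀ n → Y A n ≋ Y B n [ u ]
X-base A≋B zero = ≋-refl
X-base A≋B (suc n) = ≋-+ (≋-* (≋-+ (≋-refl {a = 1}) A≋B) (X-base A≋B n))
  (≋-* (≋-* A≋B (≋-+ (≋-refl {a = 2}) A≋B)) (Y-base A≋B n))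
Y-base A≋B zero = ≋-refl
Y-base A≋B (suc n) = ≋-+ (X-base A≋B n) (≋-* (≋-+ (≋-refl {a = 1}) A≋B) (Y-base A≋B n))

coprime-YX : ∀ A n → Coprime (Y A n) (X A n)
coprime-YX A n {d} (d∣y , d∣x) = ∣1⇒≡1 (∣m+n∣m⇒∣n
  (subst (d ∣_) (trans (XY-Pell A n) (+-comm 1 _)) (∣m⇒∣m*n (X A n) d∣x))
  (∣n⇒∣m*n (Δ A) (∣m⇒∣m*n (Y A n) d∣y)))

coprime-^ : ∀ {m n} → Coprime m n → ∀ q → Coprime m (n ^ q)
coprime-^ c zero (_ , d∣1) = ∣1⇒≡1 d∣1
coprime-^ c (suc q) = coprime-sym (coprime-*ˡ (coprime-sym c) (coprime-sym (coprime-^ c q)))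

X-multiple : ∀ A k q → X A (q * k) ≋ X A k ^ q [ Y A k ]
X-multiple A k zero = ≋-refl
X-multiple A k (suc q) = ≋-trans (≋-reflexive (X-+ A k (q * k)))
  (≋-trans (≋-+ (≋-* (≋-refl {a = X A k}) (X-multiple A k q))
             (≋-trans (≋-reflexive (identity (Δ A) (Y A k) (Y A (q * k)))) (*m≋0 (Δ A * Y A (q * k)))))
    (≋-reflexive (+-identityʳ _)))
  where
  identity : ∀ d y z → d * (y * z) ≡ d * z * y
  identity = solve-∀

-- The √Δ-part of (X_k + Y_k √Δ)^q is q X_k^(q-1) Y_k modulo Y_k²; the extra factor X_k avoids the
-- exponent q - 1.
Y-multiple : ∀ A k q → X A k * Y A (q * k) ≋ q * X A k ^ q * Y A k [ Y A k * Y A k ]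
Y-multiple A k zero = ≋-reflexive (*-zeroʳ (X A k))
Y-multiple A k (suc q) =
  ≋-trans (≋-reflexive (trans (cong (x *_) (Y-+ A k (q * k))) (lemma₁ x (Y A (q * k)) y (X A (q * k)))))
  (≋-trans (≋-+ (≋-* (≋-refl {a = x}) (Y-multiple A k q))
                (≋-* (≋-refl {a = x}) (≋-*-scale y (X-multiple A k q))))
  (≋-reflexive (lemma₂ x q (x ^ q) y)))
  where
  x = X A k
  y = Y A k
  lemma₁ : ∀ x z y w → x * (x * z + y * w) ≡ x * (x * z) + x * (y * w)
  lemma₁ = solve-∀
  lemma₂ : ∀ x q p y → x * (q * p * y) + x * (y * p) ≡ (1 + q) * (x * p) * y
  lemma₂ = solve-∀

Y∣Y-multiple : ∀ A k q → Y A k ∣ Y A (q * k)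
Y∣Y-multiple A k zero = Y A k ∣0
Y∣Y-multiple A k (suc q) = subst (Y A k ∣_) (sym (Y-+ A k (q * k)))
  (∣m∣n⇒∣m+n (∣n⇒∣m*n (X A k) (Y∣Y-multiple A k q)) (∣m⇒∣m*n (X A (q * k)) ∣-refl))

-- Division of n by the index with remainder r leaves Y_k dividing a multiple of Y_r by a number
-- coprime to Y_k; but Y_r is smaller than Y_k, so r = 0.
Y∣Y⇒∣ : ∀ A k n → Y A (suc k) ∣ Y A n → suc k ∣ n
Y∣Y⇒∣ A k′ n y∣Yn = divides (n / k) (trans n≡ (cong (_+ q * k) r≡0))
  where
  k = suc k′
  q = n / k
  r = n % k
  y = Y A k
  n≡ : n ≡ r + q * k
  n≡ = m≡m%n+[m/n]*n n k
  y∣ : y ∣ X A r * Y A (q * k) + Y A r * X A (q * k)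
  y∣ = subst (y ∣_) (trans (cong (Y A) n≡) (Y-+ A r (q * k))) y∣Yn
  y∣X*Yr : y ∣ X A (q * k) * Y A r
  y∣X*Yr = subst (y ∣_) (*-comm (Y A r) _)
    (∣m+n∣m⇒∣n y∣ (∣n⇒∣m*n (X A r) (Y∣Y-multiple A k q)))
  coprime-yX : Coprime y (X A (q * k))
  coprime-yX (d∣y , d∣x) = coprime-YX A (q * k) (∣-trans d∣y (Y∣Y-multiple A k q) , d∣x)
  r≡0 : r ≡ 0
  r≡0 with r | m%n<n n k | coprime-divisor coprime-yX y∣X*Yr
  ... | zero | _ | _ = refl
  ... | suc r′ | r<k | y∣Yr =
    contradiction y∣Yr (>⇒∤ {{>-nonZero (Y>0 A r′)}} (Y-mono-< A r<k))

-- For n = q k the expansion modulo Y_k² turns the hypothesis into Y_k ∣ q X_k^q, and X_k is coprime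
-- to Y_k.
Y²∣Y⇒∣ : ∀ A k n → Y A (suc k) * Y A (suc k) ∣ Y A n → Y A (suc k) ∣ n
Y²∣Y⇒∣ A k′ n y²∣Yn with Y∣Y⇒∣ A k′ n (m*n∣⇒m∣ (Y A (suc k′)) _ y²∣Yn)
... | divides q refl = ∣m⇒∣m*n k (coprime-divisor (coprime-^ (coprime-YX A k) q)
        (subst (y ∣_) (*-comm q _)
          (*-cancelʳ-∣ y {{>-nonZero (Y>0 A k′)}}
            (≋-pres-∣ (Y-multiple A k q) (∣n⇒∣m*n (X A k) y²∣Yn)))))
  where
  k = suc k′
  y = Y A k

Y²∣Y-multiple : ∀ A k → Y A k * Y A k ∣ Y A (Y A k * k)
Y²∣Y-multiple A k = coprime-divisor coprime
  (≋-pres-∣ (≋-sym (Y-multiple A k y)) (divides (X A k ^ y) (identity y (X A k ^ y))))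
  where
  y = Y A k
  coprime : Coprime (y * y) (X A k)
  coprime = coprime-*ˡ (coprime-YX A k) (coprime-YX A k)
  identity : ∀ y p → y * p * y ≡ p * (y * y)
  identity = solve-∀

-- Recovering an index, up to sign, from X modulo X_n

_≋±_[_] : ℕ → ℕ → ℕ → Set
a ≋± b [ u ] = a ≋ b [ u ] ⊎ u ∣ a + b

∣+-≋ʳ : ∀ {u a b c} → u ∣ a + b → b ≋ c [ u ] → u ∣ a + c
∣+-≋ʳ {a = a} d e = ≋-pres-∣ (≋-+ (≋-refl {a = a}) e) d

≋±-trans : ∀ {u a b c} → a ≋± b [ u ] → b ≋± c [ u ] → a ≋± c [ u ]
≋±-trans (inj₁ e) (inj₁ e′) = inj₁ (≋-trans e e′)
≋±-trans {c = c} (inj₁ e) (inj₂ d) = inj₂ (≋-pres-∣ (≋-+ (≋-sym e) (≋-refl {a = c})) d)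
≋±-trans (inj₂ d) (inj₁ e) = inj₂ (∣+-≋ʳ d e)
≋±-trans {b = b} {c} (inj₂ d) (inj₂ d′) = inj₁ (≋-+-cancelʳ b
  (≋-trans (∣⇒≋0 d) (≋-sym (≋-trans (≋-reflexive (+-comm c b)) (∣⇒≋0 d′)))))

X-period : ∀ A n t q → X A (t + q * (n + n)) ≋± X A t [ X A n ]
X-period A n t zero = inj₁ (≋-reflexive (cong (X A) (+-identityʳ t)))
X-period A n t (suc q) = ≋±-trans (inj₂ (divides (2 * X A (j + n))
    (trans (cong (λ z → X A z + X A j) (identity t q n))
      (trans (X-reflect A j n) (identity′ (X A n) (X A (j + n)))))))
  (X-period A n t q)
  where
  j = t + q * (n + n)
  identity : ∀ t q n → t + (1 + q) * (n + n) ≡ t + q * (n + n) + n + n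
  identity = solve-∀
  identity′ : ∀ x y → 2 * x * y ≡ 2 * y * x
  identity′ = solve-∀

-- The index is reduced modulo 2n and, if it then exceeds n, reflected about n. Signs of X and of
-- the index are lost independently.
X-fold : ∀ A n′ j → let n = suc n′ in
         ∃ λ r → r ≤ n × X A j ≋± X A r [ X A n ] × j ≋± r [ n + n ]
X-fold A n′ j with t ≤? n
  where
  n = suc n′
  t = j % (n + n)
... | yes t≤n = t , t≤n ,
  subst (λ z → X A z ≋± X A t [ X A n ]) (sym j≡) (X-period A n t q) ,
  inj₁ (≋-trans (≋-reflexive j≡) (+*m≋ t q))
  where
  n = suc n′
  t = j % (n + n)
  q = j / (n + n)
  j≡ : j ≡ t + q * (n + n)
  j≡ = m≡m%n+[m/n]*n j (n + n)
-- Here n < t < 2n. With e = t - n the reflected index is m = n - e = 2n - t, so that t = m + 2e.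
... | no t≰n = m , m∸n≤m n e ,
  ≋±-trans (subst (λ z → X A z ≋± X A t [ X A n ]) (sym j≡) (X-period A n t q))
    (inj₂ (divides (2 * X A e) (trans (cong (λ z → X A z + X A m) t≡)
      (trans (X-reflect A m e) (cong (λ z → 2 * X A e * X A z) m+e≡n))))) ,
  inj₂ (divides (1 + q) (trans (cong (_+ m) (trans j≡ (cong (_+ q * (n + n)) t≡)))
    (trans (identity m e q n) (cong₂ (λ y z → y + z + q * (n + n)) m+e≡n m+e≡n))))
  where
  n = suc n′
  t = j % (n + n)
  q = j / (n + n)
  e = t ∸ n
  m = n ∸ e
  j≡ : j ≡ t + q * (n + n)
  j≡ = m≡m%n+[m/n]*n j (n + n)
  n+e≡t : n + e ≡ t
  n+e≡t = m+[n∸m]≡n (<⇒≤ (≰⇒> t≰n))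
  m+e≡n : m + e ≡ n
  m+e≡n = m∸n+n≡m (+-cancelˡ-≤ n _ _ (subst (_≤ n + n) (sym n+e≡t) (<⇒≤ (m%n<n j (n + n)))))
  t≡ : t ≡ m + e + e
  t≡ = trans (sym n+e≡t) (cong (_+ e) (sym m+e≡n))
  identity : ∀ m e q n → m + e + e + q * (n + n) + m ≡ (m + e) + (m + e) + q * (n + n)
  identity = solve-∀

-- For indices below n, sums and differences are smaller than X_n in absolute value. The index n is
-- treated apart: X_n is 0 modulo itself, the earlier terms are not.
X-≋±-injective : ∀ {A} → 2 ≤ A → ∀ {n i r} → i ≤ n → r ≤ n → X A i ≋± X A r [ X A n ] → i ≡ r
X-≋±-injective {A} 2≤A {n} {i} {r} i≤n r≤n e with m≤n⇒m<n∨m≡n i≤n | m≤n⇒m<n∨m≡n r≤n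
... | inj₂ refl | inj₂ refl = refl
... | inj₁ i<n | inj₂ refl = contradiction (X∣ e) (>⇒∤ {{>-nonZero (X>0 A i)}} (X-mono-< 2≤A i<n))
  where
  X∣ : X A i ≋± X A r [ X A r ] → X A r ∣ X A i
  X∣ (inj₁ e) = ≋-pres-∣ (≋-sym e) ∣-refl
  X∣ (inj₂ d) = ∣m+n∣m⇒∣n (subst (X A r ∣_) (+-comm (X A i) _) d) ∣-refl
... | inj₂ refl | inj₁ r<n = contradiction (X∣ e) (>⇒∤ {{>-nonZero (X>0 A r)}} (X-mono-< 2≤A r<n))
  where
  X∣ : X A i ≋± X A r [ X A i ] → X A i ∣ X A r
  X∣ (inj₁ e) = ≋-pres-∣ e ∣-refl
  X∣ (inj₂ d) = ∣m+n∣m⇒∣n d ∣-refl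
... | inj₁ i<n | inj₁ r<n = cases e
  where
  sum< : X A i + X A r < X A n
  sum< with ≤-total (X A i) (X A r)
  ... | inj₁ i≤r = ≤-<-trans (+-monoˡ-≤ (X A r) i≤r)
                     (subst (λ z → X A r + z < X A n) (+-identityʳ (X A r)) (2X<X 2≤A r<n))
  ... | inj₂ r≤i = ≤-<-trans (+-monoʳ-≤ (X A i) r≤i)
                     (subst (λ z → X A i + z < X A n) (+-identityʳ (X A i)) (2X<X 2≤A i<n))
  cases : X A i ≋± X A r [ X A n ] → i ≡ r
  cases (inj₁ e) = X-injective 2≤A (≋⇒≡ (X-mono-< 2≤A i<n) (X-mono-< 2≤A r<n) e)
  cases (inj₂ d) = contradiction d (>⇒∤ {{>-nonZero (≤-trans (X>0 A i) (m≤m+n _ _))}} sum<)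

X-≋⇒index : ∀ {A} → 2 ≤ A → ∀ {n i} j → 0 < n → i ≤ n → X A j ≋ X A i [ X A n ] → j ≋± i [ n + n ]
X-≋⇒index {A} 2≤A {suc n} {i} j _ i≤n e =
  let r , r≤n , Xj≋±Xr , j≋±r = X-fold A n j
      i≡r = X-≋±-injective 2≤A i≤n r≤n (≋±-trans (inj₁ (≋-sym e)) Xj≋±Xr)
  in subst (λ z → j ≋± z [ suc n + suc n ]) (sym i≡r) j≋±r

-- Matiyasevich's characterisation of the k-th Pell solution

-- Let (x, y), (u, v) and (s, t) have the indices i, n and j, the last one to base B. Since y²
-- divides v, y divides n. Modulo u the parameters A and B agree, so X_j ≡ X_i modulo X_n, whence j
-- ≡ ±i modulo 2n and thus modulo 2y. As 2y divides B, also t ≡ j modulo 2y, so k ≡ ±i modulo 2y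
-- with both at most y. The factor `suc z` keeps v, and hence n, positive.
pell-sound : ∀ {A k x y u v B s t} z w → 2 ≤ A → 0 < k →
  Pell A x y → Pell A u v → Pell B s t →
  v ≡ y * y * suc z → B ≡ 2 * y * suc w →
  A ≋ B [ u ] → s ≋ x [ u ] → t ≋ k [ 2 * y ] → k ≤ y →
  x ≡ X A k × y ≡ Y A k
pell-sound {A} {k} {x} {y} {u} {v} {B} {s} {t} z w 2≤A 0<k px pu ps v≡ B≡ A≋B s≋x t≋k k≤y
  with pell-solutions A x y px | pell-solutions A u v pu | pell-solutions B s t ps
... | zero , refl , refl | _ | _ = contradiction (≤-trans 0<k k≤y) λ ()
... | suc i′ , refl , refl | n , refl , refl | j , refl , refl =
  subst (λ r → X A (suc i′) ≡ X A r × Y A (suc i′) ≡ Y A r) (sym k≡i) (refl , refl)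
  where
  i = suc i′
  yᵢ = Y A i
  yᵢ∣n : yᵢ ∣ n
  yᵢ∣n = Y²∣Y⇒∣ A i′ n (divides (suc z) (trans v≡ (*-comm (yᵢ * yᵢ) (suc z))))
  yᵢ>0 : 0 < yᵢ
  yᵢ>0 = Y>0 A i′
  0<v : 0 < Y A n
  0<v = subst (0 <_) (sym v≡) (*-mono-≤ (*-mono-≤ yᵢ>0 yᵢ>0) (s≤s {n = z} z≤n))
  0<n : 0 < n
  0<n = positive n 0<v
    where
    positive : ∀ n → 0 < Y A n → 0 < n
    positive (suc n) _ = s≤s z≤n
  i≤n : i ≤ n
  i≤n = ≤-trans (n≤Y A i) (∣⇒≤ {{>-nonZero 0<n}} yᵢ∣n)
  2y∣2n : 2 * yᵢ ∣ n + n
  2y∣2n = subst (2 * yᵢ ∣_) (cong (n +_) (+-identityʳ n)) (*-monoʳ-∣ 2 yᵢ∣n)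
  k≋j : k ≋ j [ 2 * yᵢ ]
  k≋j = ≋-trans (≋-sym t≋k) (≋-∣ (divides (suc w) (trans B≡ (*-comm (2 * yᵢ) (suc w)))) (Y≋n B j))
  i≤y : i ≤ yᵢ
  i≤y = n≤Y A i
  y<2y : yᵢ < 2 * yᵢ
  y<2y = subst (λ z → yᵢ < yᵢ + z) (sym (+-identityʳ yᵢ)) (m<m+n yᵢ yᵢ>0)
  cases : j ≋± i [ n + n ] → k ≡ i
  cases (inj₁ e) = ≋⇒≡ (≤-<-trans k≤y y<2y) (≤-<-trans i≤y y<2y) (≋-trans k≋j (≋-∣ 2y∣2n e))
  -- With the minus sign 2y divides the positive number k + i, which is at most 2y, so k and i both
  -- equal y.
  cases (inj₂ d) = trans k≡y (sym i≡y)
    where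
    2y≤k+i : yᵢ + yᵢ ≤ k + i
    2y≤k+i = subst (λ z → yᵢ + z ≤ k + i) (+-identityʳ yᵢ)
      (∣⇒≤ {{>-nonZero (≤-trans 0<k (m≤m+n k i))}}
        (≋-pres-∣ (≋-+ (≋-sym k≋j) (≋-refl {a = i})) (∣-trans 2y∣2n d)))
    k≡y : k ≡ yᵢ
    k≡y = ≤-antisym k≤y (+-cancelʳ-≤ yᵢ _ _ (≤-trans 2y≤k+i (+-monoʳ-≤ k i≤y)))
    i≡y : i ≡ yᵢ
    i≡y = ≤-antisym i≤y (+-cancelˡ-≤ yᵢ _ _ (≤-trans 2y≤k+i (+-monoˡ-≤ i k≤y)))
  k≡i : k ≡ i
  k≡i = cases (X-≋⇒index 2≤A j 0<n i≤n (≋-trans (X-base A≋B j) s≋x))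

-- The pair (u, v) has index 2m for m = y k. Index m already makes y² divide Y_m; doubling gives v =
-- 2 X_m Y_m, so that 2y divides v as well, which the choice of B relies on.
pell-complete : ∀ A′ k′ → let A = suc A′ ; k = suc k′ ; x = X A k ; y = Y A k in
  ∃ λ u → ∃ λ v → ∃ λ B → ∃ λ s → ∃ λ t → ∃ λ z → ∃ λ w →
  Pell A x y × Pell A u v × Pell B s t ×
  v ≡ y * y * suc z × B ≡ 2 * y * suc w ×
  A ≋ B [ u ] × s ≋ x [ u ] × t ≋ k [ 2 * y ] × k ≤ y
pell-complete A′ k′ =
  u , v , B , X B k , Y B k , z , w ,
  XY-Pell A k , XY-Pell A (m + m) , XY-Pell B k , v≡ , B≡ ,
  A≋B , ≋-sym (X-base A≋B k) , ≋-∣ (divides (suc w) (trans B≡ (*-comm (2 * y) (suc w)))) (Y≋n B k) ,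
  n≤Y A k
  where
  A = suc A′
  k = suc k′
  y = Y A k
  m = y * k
  u = X A (m + m)
  v = Y A (m + m)
  positive-multiple : ∀ {d a} → d ∣ a → 0 < a → ∃ λ q → a ≡ d * suc q
  positive-multiple (divides zero refl) ()
  positive-multiple {d} (divides (suc q) refl) _ = q , *-comm (suc q) d
  v≡2XY : v ≡ X A m * 2 * Y A m
  v≡2XY = trans (Y-+ A m m) (identity (X A m) (Y A m))
    where
    identity : ∀ x y → x * y + y * x ≡ x * 2 * y
    identity = solve-∀
  y²∣v : y * y ∣ v
  y²∣v = subst (y * y ∣_) (sym v≡2XY) (∣n⇒∣m*n (X A m * 2) (Y²∣Y-multiple A k))
  0<m : 0 < m
  0<m = *-mono-≤ (Y>0 A k′) (s≤s {n = k′} z≤n)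
  0<v : 0 < v
  0<v = ≤-trans 0<m (≤-trans (m≤m+n m m) (n≤Y A (m + m)))
  z = proj₁ (positive-multiple y²∣v 0<v)
  v≡ = proj₂ (positive-multiple y²∣v 0<v)
  2y∣v : 2 * y ∣ v
  2y∣v = subst (2 * y ∣_) (sym (trans v≡2XY (*-assoc (X A m) 2 _)))
    (∣n⇒∣m*n (X A m) (*-monoʳ-∣ 2 (Y∣Y-multiple A k y)))
  y⁻ = pred y
  y≡ : y ≡ suc y⁻
  y≡ = sym (suc-pred y {{>-nonZero (Y>0 A k′)}})
  -- u² ≡ 1 (mod v), so B ≡ A (1 + (2y − 1)) ≡ 0 (mod 2y).
  B = A + A * (2 * y⁻ + 1) * u * u
  B≡′ : B ≡ A * (2 * y) + A * (2 * y⁻ + 1) * Δ A * v * v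
  B≡′ = trans (cong (A +_) (*-assoc (A * (2 * y⁻ + 1)) u u))
    (trans (cong (λ z → A + A * (2 * y⁻ + 1) * z) (XY-Pell A (m + m)))
    (trans (identity A y⁻ (Δ A) v)
           (cong (λ z → A * (2 * z) + A * (2 * y⁻ + 1) * Δ A * v * v) (sym y≡))))
    where
    identity : ∀ A y d v → A + A * (2 * y + 1) * (1 + d * (v * v))
                         ≡ A * (2 * (1 + y)) + A * (2 * y + 1) * d * v * v
    identity = solve-∀
  2y∣B : 2 * y ∣ B
  2y∣B = subst (2 * y ∣_) (sym B≡′)
    (∣m∣n⇒∣m+n (n∣m*n A) (∣n⇒∣m*n (A * (2 * y⁻ + 1) * Δ A * v) 2y∣v))
  w = proj₁ (positive-multiple 2y∣B (s≤s z≤n))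
  B≡ = proj₂ (positive-multiple 2y∣B (s≤s z≤n))
  A≋B : A ≋ B [ u ]
  A≋B = ≋-sym (+*m≋ A (A * (2 * y⁻ + 1) * u))

-- Order, congruence and the Pell sequences as Diophantine relations

index : ∀ i {k} → Fin (suc (i + k))
index zero = zero
index (suc i) = suc (index i)

-- The variable bound by the i-th innermost ex.
v : ∀ i {k} → Tm (suc (i + k))
v i = var (index i)

𝟚 : ∀ {k} → Tm k
𝟚 = 𝟙 ⊕ 𝟙

infixl 8 _!_
_!_ : ∀ {k} → Vec ℕ (suc k) → Fin (suc k) → ℕ
_!_ = lookup

≋-Dio : Dio {3} λ ν → lookup ν zero ≋ lookup ν (suc zero) [ lookup ν (suc (suc zero)) ]
≋-Dio = ex (ex (v 2 ⊕ v 1 ⊗ v 4 ≐ v 3 ⊕ v 0 ⊗ v 4))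

≤-Dio : Dio {2} λ ν → lookup ν zero ≤ lookup ν (suc zero)
≤-Dio = iff (λ { (a ∷ b ∷ []) (c , refl) → m≤m+n a c }) (λ _ h → m≤n⇒∃[o]m+o≡n h) (ex (v 1 ⊕ v 0 ≐ v 2))

infix 4 _≼_ _≺_

_≼_ : ∀ {k} (s t : Tm k) → Dio (λ ν → ⟦ s ⟧ ν ≤ ⟦ t ⟧ ν)
s ≼ t = call ≤-Dio (s ∷ t ∷ [])

_≺_ : ∀ {k} (s t : Tm k) → Dio (λ ν → ⟦ s ⟧ ν < ⟦ t ⟧ ν)
s ≺ t = 𝟙 ⊕ s ≼ t

cong-Dio : ∀ {k} (s t u : Tm k) → Dio (λ ν → ⟦ s ⟧ ν ≋ ⟦ t ⟧ ν [ ⟦ u ⟧ ν ])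
cong-Dio s t u = call ≋-Dio (s ∷ t ∷ u ∷ [])

Pell-Dio : ∀ {k} (A x y : Tm k) → Dio (λ ν → Pell (⟦ A ⟧ ν) (⟦ x ⟧ ν) (⟦ y ⟧ ν))
Pell-Dio A x y = x ⊗ x ≐ 𝟙 ⊕ A ⊗ (𝟚 ⊕ A) ⊗ (y ⊗ y)

-- The shifts by 2 and 1 build the hypotheses 2 ≤ A and 0 < k into the relation.
XY-Dio : Dio {4} λ ν → ν ! index 2 ≡ X (2 + ν ! index 0) (1 + ν ! index 1)
                     × ν ! index 3 ≡ Y (2 + ν ! index 0) (1 + ν ! index 1)
XY-Dio = iff
  (λ { _ (u , v , B , s , t , z , w , px , pu , ps , v≡ , B≡ , A≋B , s≋x , t≋k , k≤y) →
       pell-sound z w (s≤s (s≤s z≤n)) (s≤s z≤n) px pu ps v≡ B≡ A≋B s≋x t≋k k≤y })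
  (λ { (A ∷ k ∷ _ ∷ _ ∷ []) (refl , refl) → pell-complete (suc A) k })
  (ex (ex (ex (ex (ex (ex (ex
    ( Pell-Dio A x y ∧ Pell-Dio A u v′ ∧ Pell-Dio B s t
    ∧ v′ ≐ y ⊗ y ⊗ (𝟙 ⊕ z) ∧ B ≐ 𝟚 ⊗ y ⊗ (𝟙 ⊕ w)
    ∧ cong-Dio A B u ∧ cong-Dio s x u ∧ cong-Dio t k (𝟚 ⊗ y) ∧ k ≼ y))))))))
  where
  u v′ B s t z w A k x y : Tm 11
  u = v 6
  v′ = v 5
  B = v 4
  s = v 3
  t = v 2
  z = v 1
  w = v 0
  A = 𝟚 ⊕ v 7
  k = 𝟙 ⊕ v 8
  x = v 9
  y = v 10

-- Exponentiation

-- A Pell value bounds a power before powers are known to be Diophantine; it makes a sufficiently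
-- large modulus definable.
^≤Y : ∀ A n → suc A ^ n ≤ Y A (suc n)
^≤Y A zero = s≤s z≤n
^≤Y A (suc n) = ≤-trans (*-monoʳ-≤ (suc A) (^≤Y A n)) (m≤n+m _ (X A (suc n)))

-- Modulo D, m − a is a square root of Δ, whence X + Y (m − a) ≡ (a + (m − a))ⁿ = mⁿ.
XY≋^ : ∀ A m D → D + (m * m + 1) ≡ 2 * (suc A * m) →
       ∀ n → X A n + m * Y A n ≋ m ^ n + suc A * Y A n [ D ]
XY≋^ A m D D≡ zero = ≋-reflexive (cong suc (trans (*-zeroʳ m) (sym (*-zeroʳ (suc A)))))
XY≋^ A m D D≡ (suc n) = ≋-+-cancelʳ (m * m * y)
  (≋-trans (≋-reflexive (lemma₁ A m x y))
  (≋-trans (≋-+ (≋-refl {a = suc A * x + Δ A * y + m * (suc A * y)}) (≋-* (≋-refl {a = m}) (XY≋^ A m D D≡ n)))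
  (≋-trans (≋-reflexive (trans (lemma₂ A m x y p) (trans (cong (λ z → m * p + (suc A * x + Δ A * y) + z * y) (sym D≡)) (lemma₃ A m x y p D))))
           (+*m≋ _ y))))
  where
  x = X A n
  y = Y A n
  p = m ^ n
  lemma₁ : ∀ A m x y → (1 + A) * x + A * (2 + A) * y + m * (x + (1 + A) * y) + m * m * y
         ≡ (1 + A) * x + A * (2 + A) * y + m * ((1 + A) * y) + m * (x + m * y)
  lemma₁ = solve-∀
  lemma₂ : ∀ A m x y p → (1 + A) * x + A * (2 + A) * y + m * ((1 + A) * y) + m * (p + (1 + A) * y)
         ≡ m * p + ((1 + A) * x + A * (2 + A) * y) + 2 * ((1 + A) * m) * y
  lemma₂ = solve-∀
  lemma₃ : ∀ A m x y p D → m * p + ((1 + A) * x + A * (2 + A) * y) + (D + (m * m + 1)) * y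
         ≡ m * p + (1 + A) * (x + (1 + A) * y) + m * m * y + y * D
  lemma₃ = solve-∀

-- D = 2am − m² − 1 for m = 1 + m′ and a = 3 + p + m′.
exp-modulus : ℕ → ℕ → ℕ
exp-modulus m′ p = 4 + 6 * m′ + 2 * p + 2 * p * m′ + m′ * m′

exp-modulus-≡ : ∀ m′ p → exp-modulus m′ p + (suc m′ * suc m′ + 1) ≡ 2 * ((3 + (p + m′)) * suc m′)
exp-modulus-≡ = identity
  where
  identity : ∀ m p → 4 + 6 * m + 2 * p + 2 * p * m + m * m + ((1 + m) * (1 + m) + 1)
                   ≡ 2 * ((3 + (p + m)) * (1 + m))
  identity = solve-∀

p<exp-modulus : ∀ m′ p → p < exp-modulus m′ p
p<exp-modulus m′ p = subst (p <_) (sym (identity m′ p)) (s≤s (m≤m+n p _))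
  where
  identity : ∀ m p → 4 + 6 * m + 2 * p + 2 * p * m + m * m ≡ 1 + (p + (3 + 6 * m + p + 2 * p * m + m * m))
  identity = solve-∀

-- `p` is at least m^(n+1) and D exceeds `p`, so the residue modulo D determines the power. `XY-Dio`
-- supplies only positive indices, so c m is compared with m^(n+1) and the positive m is cancelled.
^-sound : ∀ m′ n c {x y p q} → let m = suc m′ ; A = 2 + (p + m′) ; D = exp-modulus m′ p in
  q ≡ X (2 + m′) (2 + n) × p ≡ Y (2 + m′) (2 + n) →
  x ≡ X A (suc n) × y ≡ Y A (suc n) →
  (c * m < D → x + m * y ≋ c * m + suc A * y [ D ] → c ≡ m ^ n) ×
  (c ≡ m ^ n → c * m < D × x + m * y ≋ c * m + suc A * y [ D ])
^-sound m′ n c {p = p} (_ , p≡) (refl , refl) = to , from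
  where
  m = suc m′
  A = 2 + (p + m′)
  D = exp-modulus m′ p
  y = Y A (suc n)
  key : X A (suc n) + m * y ≋ m ^ suc n + suc A * y [ D ]
  key = XY≋^ A m D (exp-modulus-≡ m′ p) (suc n)
  m^<D : m ^ suc n < D
  m^<D = ≤-<-trans (≤-trans (^-monoˡ-≤ (suc n) (m≤n+m m 2))
    (subst (suc (2 + m′) ^ suc n ≤_) (sym p≡) (^≤Y (2 + m′) (suc n)))) (p<exp-modulus m′ p)
  to : c * m < D → X A (suc n) + m * y ≋ c * m + suc A * y [ D ] → c ≡ m ^ n
  to cm<D e = *-cancelʳ-≡ c (m ^ n) m (trans
    (≋⇒≡ cm<D m^<D (≋-+-cancelʳ (suc A * y) (≋-trans (≋-sym e) key))) (*-comm m (m ^ n)))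
  from : c ≡ m ^ n → c * m < D × X A (suc n) + m * y ≋ c * m + suc A * y [ D ]
  from refl = subst (_< D) (*-comm m (m ^ n)) m^<D ,
              subst (λ z → X A (suc n) + m * y ≋ z + suc A * y [ D ]) (*-comm m (m ^ n)) key

^-Dio : Dio {3} λ ν → ν ! index 2 ≡ suc (ν ! index 0) ^ (ν ! index 1)
^-Dio = iff
  (λ { (m ∷ n ∷ c ∷ []) (q , p , x , y , pq , xy , c< , e) → proj₁ (^-sound m n c pq xy) c< e })
  (λ { (m ∷ n ∷ c ∷ []) c≡ → X (2 + m) (2 + n) , Y (2 + m) (2 + n) ,
         X (2 + (Y (2 + m) (2 + n) + m)) (suc n) , Y (2 + (Y (2 + m) (2 + n) + m)) (suc n) ,
         (refl , refl) , (refl , refl) , proj₂ (^-sound m n c (refl , refl) (refl , refl)) c≡ })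
  (ex (ex (ex (ex
    ( call XY-Dio (m′ ∷ 𝟙 ⊕ n ∷ q ∷ p ∷ [])
    ∧ call XY-Dio (p ⊕ m′ ∷ n ∷ x ∷ y ∷ [])
    ∧ c ⊗ m ≺ D
    ∧ cong-Dio (x ⊕ m ⊗ y) (c ⊗ m ⊕ a ⊗ y) D)))))
  where
  q p x y m′ n c m a D : Tm 7
  q = v 3
  p = v 2
  x = v 1
  y = v 0
  m′ = v 4
  n = v 5
  c = v 6
  m = 𝟙 ⊕ m′
  a = 𝟙 ⊕ (𝟚 ⊕ (p ⊕ m′))
  𝟜 : Tm 7
  𝟜 = 𝟚 ⊕ 𝟚
  D = 𝟜 ⊕ (𝟜 ⊕ 𝟚) ⊗ m′ ⊕ 𝟚 ⊗ p ⊕ 𝟚 ⊗ p ⊗ m′ ⊕ m′ ⊗ m′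

-- Digits as an encoding of finite sequences

quotient-unique : ∀ {b} r q r′ q′ → r < b → r′ < b → r + b * q ≡ r′ + b * q′ → r ≡ r′ × q ≡ q′
quotient-unique {b} r q r′ q′ r<b r′<b e = r≡r′ ,
  *-cancelˡ-≡ q q′ b {{>-nonZero (≤-<-trans z≤n r<b)}}
    (+-cancelˡ-≡ r _ _ (trans e (cong (_+ b * q′) (sym r≡r′))))
  where
  r≡r′ : r ≡ r′
  r≡r′ = ≋⇒≡ r<b r′<b (q , q′ , trans (cong (r +_) (*-comm q b)) (trans e (cong (r′ +_) (*-comm b q′))))

-- The base is 1 + q.
Digit : ℕ → ℕ → ℕ → ℕ → Set
Digit s q i a = ∃ λ lo → ∃ λ hi →
  s ≡ lo + suc q ^ i * (a + suc q * hi) × lo < suc q ^ i × a < suc q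

digit-unique : ∀ {s q i a b} → Digit s q i a → Digit s q i b → a ≡ b
digit-unique {q = q} {i} {a} {b} (lo , hi , s≡ , lo< , a<) (lo′ , hi′ , s≡′ , lo<′ , b<) =
  proj₁ (quotient-unique a hi b hi′ a< b<
    (proj₂ (quotient-unique {suc q ^ i} lo _ lo′ _ lo< lo<′ (trans (sym s≡) s≡′))))

digit-zero : ∀ {q} a s → a < suc q → Digit (a + suc q * s) q 0 a
digit-zero a s a< = 0 , s , sym (+-identityʳ _) , s≤s z≤n , a<

digit-suc : ∀ {q} b s i {a} → b < suc q → Digit s q i a → Digit (b + suc q * s) q (suc i) a
digit-suc {q} b s i {a} b< (lo , hi , s≡ , lo< , a<) =
  b + suc q * lo , hi ,
  trans (cong (λ z → b + suc q * z) s≡) (identity b (suc q) lo (suc q ^ i) (a + suc q * hi)) ,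
  ≤-trans (+-monoˡ-< (suc q * lo) b<)
    (≤-trans (≤-reflexive (sym (*-suc (suc q) lo))) (*-monoʳ-≤ (suc q) lo<)) ,
  a<
  where
  identity : ∀ b Q lo P h → b + Q * (lo + P * h) ≡ b + Q * lo + Q * P * h
  identity = solve-∀

bound : (ℕ → ℕ) → ℕ → ℕ
bound f zero = 0
bound f (suc n) = bound f n + f n

≤bound : ∀ f {i n} → i < n → f i ≤ bound f n
≤bound f {n = suc n} i<1+n with m<1+n⇒m<n∨m≡n i<1+n
... | inj₁ i<n = ≤-trans (≤bound f i<n) (m≤m+n _ _)
... | inj₂ refl = m≤n+m (f n) _

digits-exist : ∀ q n (f : ℕ → ℕ) → (∀ {i} → i < n → f i < suc q) →
               ∃ λ s → ∀ {i} → i < n → Digit s q i (f i)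
digits-exist q zero f f< = 0 , λ ()
digits-exist q (suc n) f f< =
  let s , ds = digits-exist q n (λ i → f (suc i)) (λ i<n → f< (s≤s i<n))
  in f 0 + suc q * s , λ { {zero} _ → digit-zero (f 0) s (f< (s≤s z≤n))
                         ; {suc i} (s≤s i<n) → digit-suc (f 0) s i (f< (s≤s z≤n)) (ds i<n) }

sequence-exists : ∀ n (f : ℕ → ℕ) → ∃ λ q → ∃ λ s → ∀ {i} → i < n → Digit s q i (f i)
sequence-exists n f = bound f n , digits-exist (bound f n) n f (λ i<n → s≤s (≤bound f i<n))

Digit-Dio : Dio {4} λ ν → Digit (ν ! index 0) (ν ! index 1) (ν ! index 2) (ν ! index 3)
Digit-Dio = iff
  (λ { (s ∷ q ∷ i ∷ a ∷ []) (lo , hi , p , refl , h) → lo , hi , h })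
  (λ { (s ∷ q ∷ i ∷ a ∷ []) (lo , hi , h) → lo , hi , suc q ^ i , refl , h })
  (ex (ex (ex
    ( call ^-Dio (q ∷ i ∷ p ∷ [])
    ∧ s ≐ lo ⊕ p ⊗ (a ⊕ (𝟙 ⊕ q) ⊗ hi)
    ∧ lo ≺ p ∧ a ≺ 𝟙 ⊕ q))))
  where
  lo hi p s q i a : Tm 7
  lo = v 2
  hi = v 1
  p = v 0
  s = v 3
  q = v 4
  i = v 5
  a = v 6

-- Binomial coefficients

binom : ℕ → ℕ → ℕ
binom n zero = 1
binom zero (suc k) = 0
binom (suc n) (suc k) = binom n k + binom n (suc k)

binom≤2^ : ∀ n k → binom n k ≤ 2 ^ n
binom≤2^ zero zero = ≤-refl
binom≤2^ zero (suc k) = z≤n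
binom≤2^ (suc n) zero = m^n>0 2 (suc n)
binom≤2^ (suc n) (suc k) =
  +-mono-≤ (binom≤2^ n k) (subst (binom n (suc k) ≤_) (sym (+-identityʳ (2 ^ n))) (binom≤2^ n (suc k)))

-- Σ_{j ≥ k} binom n j Q^(j−k)
upperSum : ℕ → ℕ → ℕ → ℕ
upperSum Q n zero = suc Q ^ n
upperSum Q zero (suc k) = 0
upperSum Q (suc n) (suc k) = upperSum Q n k + upperSum Q n (suc k)

upperSum-step : ∀ Q n k → upperSum Q n k ≡ binom n k + Q * upperSum Q n (suc k)
upperSum-step Q zero zero = cong suc (sym (*-zeroʳ Q))
upperSum-step Q zero (suc k) = sym (*-zeroʳ Q)
upperSum-step Q (suc n) zero = trans (cong (_+ Q * suc Q ^ n) (upperSum-step Q n zero))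
  (identity Q (upperSum Q n 1) (suc Q ^ n))
  where
  identity : ∀ Q t p → 1 + Q * t + Q * p ≡ 1 + Q * (p + t)
  identity = solve-∀
upperSum-step Q (suc n) (suc k) = trans (cong₂ _+_ (upperSum-step Q n k) (upperSum-step Q n (suc k)))
  (identity Q (binom n k) (binom n (suc k)) (upperSum Q n (suc k)) (upperSum Q n (suc (suc k))))
  where
  identity : ∀ Q b c s t → b + Q * s + (c + Q * t) ≡ b + c + Q * (s + t)
  identity = solve-∀

-- Every coefficient is below Q, so there are no carries: the terms of degree below k add up to less
-- than Q^k.
binomial-expansion : ∀ Q n → (∀ j → binom n j < Q) → ∀ k →
                     ∃ λ lo → suc Q ^ n ≡ lo + Q ^ k * upperSum Q n k × lo < Q ^ k
binomial-expansion Q n b<Q zero = 0 , sym (+-identityʳ _) , s≤s z≤n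
binomial-expansion Q n b<Q (suc k) =
  let lo , e , lo< = binomial-expansion Q n b<Q k
      b = binom n k
  in lo + Q ^ k * b ,
     trans e (trans (cong (λ z → lo + Q ^ k * z) (upperSum-step Q n k))
       (identity lo (Q ^ k) b Q (upperSum Q n (suc k)))) ,
     ≤-trans (+-monoˡ-< (Q ^ k * b) lo<)
       (≤-trans (≤-reflexive (sym (*-suc (Q ^ k) b)))
       (≤-trans (*-monoʳ-≤ (Q ^ k) (b<Q k)) (≤-reflexive (*-comm (Q ^ k) Q))))
  where
  identity : ∀ lo p b Q t → lo + p * (b + Q * t) ≡ lo + p * b + Q * p * t
  identity = solve-∀

-- The base Q = 1 + 2^n exceeds all coefficients of row n; `Digit` takes Q - 1 as its parameter.
binom-digit : ∀ n k → Digit (suc (suc (2 ^ n)) ^ n) (2 ^ n) k (binom n k)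
binom-digit n k =
  let lo , e , lo< = binomial-expansion (suc (2 ^ n)) n (λ j → s≤s (binom≤2^ n j)) k
  in lo , upperSum (suc (2 ^ n)) n (suc k) ,
     trans e (cong (λ z → lo + suc (2 ^ n) ^ k * z) (upperSum-step (suc (2 ^ n)) n k)) ,
     lo< , s≤s (binom≤2^ n k)

binom-Dio : Dio {3} λ ν → ν ! index 2 ≡ binom (ν ! index 0) (ν ! index 1)
binom-Dio = iff
  (λ { (n ∷ k ∷ c ∷ []) (q , s , refl , refl , d) → digit-unique {i = k} d (binom-digit n k) })
  (λ { (n ∷ k ∷ c ∷ []) refl → 2 ^ n , suc (suc (2 ^ n)) ^ n , refl , refl , binom-digit n k })
  (ex (ex
    ( call ^-Dio (𝟙 ∷ v 2 ∷ v 1 ∷ [])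
    ∧ call ^-Dio (𝟙 ⊕ v 1 ∷ v 2 ∷ v 0 ∷ [])
    ∧ call Digit-Dio (v 0 ∷ v 1 ∷ v 3 ∷ v 4 ∷ []))))

binom≡0 : ∀ {n k} → n < k → binom n k ≡ 0
binom≡0 {zero} {suc k} _ = refl
binom≡0 {suc n} {suc k} (s≤s n<k) = cong₂ _+_ (binom≡0 n<k) (binom≡0 (m<n⇒m<1+n n<k))

-- Truncated subtraction does no harm, since both sides vanish when k exceeds n.
binom-step : ∀ n k → suc k * binom n (suc k) ≡ (n ∸ k) * binom n k
binom-step zero k = trans (*-zeroʳ k) (cong (_* binom 0 k) (sym (0∸n≡0 k)))
binom-step (suc n) zero = cong suc (trans (cong (_+ 0) (trans (sym (+-identityʳ _)) (binom-step n 0))) (+-identityʳ (n * 1)))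
binom-step (suc n) (suc k) = begin
  (2 + k) * (b₁ + b₂)                        ≡⟨ l₁ k b₁ b₂ ⟩
  (1 + k) * b₁ + ((2 + k) * b₂ + b₁)         ≡⟨ cong₂ (λ p q → p + (q + b₁)) (binom-step n k) (binom-step n (suc k)) ⟩
  (n ∸ k) * b₀ + ((n ∸ suc k) * b₁ + b₁)     ≡⟨ cong ((n ∸ k) * b₀ +_) last-two ⟩
  (n ∸ k) * b₀ + (n ∸ k) * b₁                ≡⟨ sym (*-distribˡ-+ (n ∸ k) b₀ b₁) ⟩
  (n ∸ k) * (b₀ + b₁)                        ∎
  where
  open ≡-Reasoning
  b₀ = binom n k
  b₁ = binom n (suc k)
  b₂ = binom n (suc (suc k))
  l₁ : ∀ k b c → (2 + k) * (b + c) ≡ (1 + k) * b + ((2 + k) * c + b)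
  l₁ = solve-∀
  last-two : (n ∸ suc k) * b₁ + b₁ ≡ (n ∸ k) * b₁
  last-two with suc k ≤? n
  ... | yes k<n = trans (+-comm _ b₁) (cong (_* b₁) (sym (∸-suc k<n)))
    where
    ∸-suc : k < n → n ∸ k ≡ suc (n ∸ suc k)
    ∸-suc k<n = +-cancelˡ-≡ k _ _ (trans (m+[n∸m]≡n (<⇒≤ k<n))
      (sym (trans (+-suc k _) (m+[n∸m]≡n k<n))))
  ... | no k≮n rewrite binom≡0 (≰⇒> k≮n) =
    trans (cong (_+ 0) (*-zeroʳ (n ∸ suc k))) (sym (*-zeroʳ (n ∸ k)))

-- Factorials

falling : ℕ → ℕ → ℕ
falling r zero = 1
falling r (suc n) = (r ∸ n) * falling r n

!*binom : ∀ r n → n ! * binom r n ≡ falling r n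
!*binom r zero = refl
!*binom r (suc n) = begin
  suc n * n ! * binom r (suc n)   ≡⟨ l (suc n) (n !) (binom r (suc n)) ⟩
  n ! * (suc n * binom r (suc n)) ≡⟨ cong (n ! *_) (binom-step r n) ⟩
  n ! * ((r ∸ n) * binom r n)     ≡⟨ l′ (n !) (r ∸ n) (binom r n) ⟩
  (r ∸ n) * (n ! * binom r n)     ≡⟨ cong ((r ∸ n) *_) (!*binom r n) ⟩
  (r ∸ n) * falling r n           ∎
  where
  open ≡-Reasoning
  l : ∀ a b c → a * b * c ≡ b * (a * c)
  l = solve-∀
  l′ : ∀ a b c → a * (b * c) ≡ b * (a * c)
  l′ = solve-∀

falling≤^ : ∀ r n → falling r n ≤ r ^ n
falling≤^ r zero = ≤-refl
falling≤^ r (suc n) = *-mono-≤ (m∸n≤m r n) (falling≤^ r n)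

-- Replacing the factors r by r - i for i < n loses at most n² r^(n-1); the extra factor r avoids
-- the exponent n - 1.
^≤falling : ∀ r n → r * r ^ n ≤ r * falling r n + n * n * r ^ n
^≤falling r zero = m≤m+n _ _
^≤falling r (suc n) = begin
  r * (r * p)                                  ≤⟨ *-monoʳ-≤ r (^≤falling r n) ⟩
  r * (r * f + n * n * p)                      ≤⟨ *-monoʳ-≤ r (+-monoˡ-≤ (n * n * p) (*-monoˡ-≤ f (m≤n+m∸n r n))) ⟩
  r * ((n + (r ∸ n)) * f + n * n * p)          ≡⟨ l₁ r n (r ∸ n) f p ⟩
  r * ((r ∸ n) * f) + r * (n * f + n * n * p)  ≤⟨ +-monoʳ-≤ (r * ((r ∸ n) * f)) (*-monoʳ-≤ r (+-monoˡ-≤ (n * n * p) (*-monoʳ-≤ n (falling≤^ r n)))) ⟩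
  r * ((r ∸ n) * f) + r * (n * p + n * n * p)  ≤⟨ +-monoʳ-≤ (r * ((r ∸ n) * f)) (≤-trans (m≤m+n _ _) (≤-reflexive (sym (l₂ r n p)))) ⟩
  r * ((r ∸ n) * f) + suc n * suc n * (r * p)  ∎
  where
  open ≤-Reasoning
  p = r ^ n
  f = falling r n
  l₁ : ∀ r n m f p → r * ((n + m) * f + n * n * p) ≡ r * (m * f) + r * (n * f + n * n * p)
  l₁ = solve-∀
  l₂ : ∀ r n p → (1 + n) * (1 + n) * (r * p) ≡ r * (n * p + n * n * p) + (1 + n) * r * p
  l₂ = solve-∀

!≤^ : ∀ n → n ! ≤ suc n ^ n
!≤^ zero = ≤-refl
!≤^ (suc n) = *-mono-≤ (n≤1+n (suc n)) (≤-trans (!≤^ n) (^-monoˡ-≤ n (n≤1+n (suc n))))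

module _ (n : ℕ) where
  -- Any r above n! n² + n² would do: then r^n differs from n! (r choose n) by less than (r choose
  -- n). This bound is built from a single power, hence available to `^-Dio`.
  radix : ℕ
  radix = suc (2 * suc n ^ (2 + n))

  private
    r = radix
    p = r ^ n
    f = falling r n
    b = binom r n

    !n²<r : n ! * (n * n) + n * n < r
    !n²<r = s≤s (begin
      n ! * (n * n) + n * n             ≤⟨ +-mono-≤ (*-mono-≤ (!≤^ n) n²≤) (≤-trans n²≤ (m≤n*m _ (suc n ^ n) {{m^n≢0 (suc n) n}})) ⟩
      e * (suc n * suc n) + e * (suc n * suc n) ≡⟨ l e (suc n) ⟩
      2 * (suc n * (suc n * e))         ∎)
      where
      open ≤-Reasoning
      e = suc n ^ n
      n²≤ : n * n ≤ suc n * suc n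
      n²≤ = *-mono-≤ (n≤1+n n) (n≤1+n n)
      l : ∀ e m → e * (m * m) + e * (m * m) ≡ 2 * (m * (m * e))
      l = solve-∀

    !n²p<rf : n ! * (n * n) * p < r * f
    !n²p<rf = +-cancelʳ-< (n * n * p) _ _ (<-≤-trans
      (subst (_< r * p) (l (n ! * (n * n)) (n * n) p) (*-monoˡ-< p {{m^n≢0 r n}} !n²<r))
      (^≤falling r n))
      where
      l : ∀ a b p → (a + b) * p ≡ a * p + b * p
      l = solve-∀

    !p<!f+f : n ! * p < n ! * f + f
    !p<!f+f = *-cancelˡ-< r _ _ (begin-strict
      r * (n ! * p)                           ≡⟨ l₁ r (n !) p ⟩
      n ! * (r * p)                           ≤⟨ *-monoʳ-≤ (n !) (^≤falling r n) ⟩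
      n ! * (r * f + n * n * p)               ≡⟨ l₂ (n !) r f (n * n) p ⟩
      n ! * (r * f) + n ! * (n * n) * p       <⟨ +-monoʳ-< (n ! * (r * f)) !n²p<rf ⟩
      n ! * (r * f) + r * f                   ≡⟨ l₃ (n !) r f ⟩
      r * (n ! * f + f)                       ∎)
      where
      open ≤-Reasoning
      l₁ : ∀ r t p → r * (t * p) ≡ t * (r * p)
      l₁ = solve-∀
      l₂ : ∀ t r f m p → t * (r * f + m * p) ≡ t * (r * f) + t * m * p
      l₂ = solve-∀
      l₃ : ∀ t r f → t * (r * f) + r * f ≡ r * (t * f + f)
      l₃ = solve-∀

    p<f+b : p < f + b
    p<f+b = *-cancelˡ-< (n !) _ _ (subst (n ! * p <_)
      (trans (cong (n ! * f +_) (sym (!*binom r n))) (sym (*-distribˡ-+ (n !) f b))) !p<!f+f)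

  radix^-division : ∃ λ rest → radix ^ n ≡ rest + binom radix n * n ! × rest < binom radix n
  radix^-division = p ∸ f ,
    trans (sym (m∸n+n≡m (falling≤^ r n))) (cong (p ∸ f +_) (trans (sym (!*binom r n)) (*-comm (n !) b))) ,
    +-cancelʳ-< f _ _ (subst₂ _<_ (sym (m∸n+n≡m (falling≤^ r n))) (+-comm f b) p<f+b)

!-Dio : Dio {2} λ ν → ν ! index 1 ≡ (ν ! index 0) !
!-Dio = iff
  (λ { (n ∷ t ∷ []) (e , p , b , rest , refl , refl , refl , p≡ , rest<) →
       let rest′ , p≡′ , rest<′ = radix^-division n
       in proj₂ (quotient-unique rest t rest′ (n !) rest< rest<′ (trans (sym p≡) p≡′)) })
  (λ { (n ∷ t ∷ []) refl →
       let rest , p≡ , rest< = radix^-division n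
       in suc n ^ (2 + n) , radix n ^ n , binom (radix n) n , rest , refl , refl , refl , p≡ , rest< })
  (ex (ex (ex (ex
    ( call ^-Dio (n ∷ 𝟚 ⊕ n ∷ e ∷ [])
    ∧ call ^-Dio (𝟚 ⊗ e ∷ n ∷ p ∷ [])
    ∧ call binom-Dio (𝟙 ⊕ 𝟚 ⊗ e ∷ n ∷ b ∷ [])
    ∧ p ≐ rest ⊕ b ⊗ t
    ∧ rest ≺ b)))))
  where
  e p b rest n t : Tm 6
  e = v 3
  p = v 2
  b = v 1
  rest = v 0
  n = v 4
  t = v 5

-- Prime divisors and the moduli of the bounded quantifier

prime-divisor : ∀ m → 1 < m → ∃ λ p → Prime p × p ∣ m
prime-divisor m 1<m = go factors isFactorisation factorsPrime
  where
  open PrimeFactorisation (factorise m {{>-nonZero (<-trans (s≤s z≤n) 1<m)}})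
  go : ∀ ps → m ≡ product ps → All Prime ps → ∃ λ p → Prime p × p ∣ m
  go [] m≡1 _ = contradiction (sym m≡1) (<⇒≢ 1<m)
  go (p ∷ ps) m≡ (pr ∷ _) = p , pr , divides (product ps) (trans m≡ (*-comm p _))

1<prime : ∀ {p} → Prime p → 1 < p
1<prime {p} pr = nonTrivial⇒n>1 p {{prime⇒nonTrivial pr}}

≋-prod : ∀ ms n {a b} → PairwiseCoprime ms n → (∀ {i} → i < n → a ≋ b [ ms i ]) → a ≋ b [ prod ms n ]
≋-prod ms n {a} {b} c e = cases (≤-total a b)
  where
  ordered : ∀ {a b} → a ≤ b → (∀ {i} → i < n → b ≋ a [ ms i ]) → b ≋ a [ prod ms n ]
  ordered {a} a≤b e with m≤n⇒∃[o]m+o≡n a≤b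
  ... | k , refl with prod-∣ ms n c (λ i<n → ≋⇒∣∸ k (e i<n))
  ...   | divides q refl = +*m≋ a q
  cases : a ≤ b ⊎ b ≤ a → a ≋ b [ prod ms n ]
  cases (inj₁ a≤b) = ≋-sym (ordered a≤b (λ i<n → ≋-sym (e i<n)))
  cases (inj₂ b≤a) = ordered b≤a e

-- A prime that divides a (a - 1) ... (a - n + 1) divides one of the factors.
∣falling⇒residue : ∀ {p} → Prime p → ∀ a n → p ∣ falling a n → ∃ λ z → z < n × a ≋ z [ p ]
∣falling⇒residue pr a zero p∣1 = contradiction (∣1⇒≡1 p∣1) (λ p≡1 → <⇒≢ (1<prime pr) (sym p≡1))
∣falling⇒residue pr a (suc n) p∣ with euclidsLemma (a ∸ n) (falling a n) pr p∣
... | inj₂ p∣f = let z , z<n , e = ∣falling⇒residue pr a n p∣f in z , m<n⇒m<1+n z<n , e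
... | inj₁ p∣a∸n with n ≤? a
...   | yes n≤a = n , n<1+n n , ∣-≋ n≤a p∣a∸n
-- The factor `a ∸ n` is 0 here, and its divisibility says nothing; but a < n is its own residue.
...   | no n≰a = a , m<n⇒m<1+n (≰⇒> n≰a) , ≋-refl

residue⇒∣falling : ∀ {m} a n {z} → z < n → a ≋ z [ m ] → m ∣ falling a n
residue⇒∣falling {m} a (suc n) z<1+n e with m<1+n⇒m<n∨m≡n z<1+n
... | inj₁ z<n = ∣n⇒∣m*n (a ∸ n) (residue⇒∣falling a n z<n e)
... | inj₂ refl = ∣m⇒∣m*n (falling a n) (m∣a∸n (≤-total n a))
  where
  m∣a∸n : n ≤ a ⊎ a ≤ n → m ∣ a ∸ n
  m∣a∸n (inj₁ n≤a) = ≋⇒∣∸ (a ∸ n) (≋-trans (≋-reflexive (m+[n∸m]≡n n≤a)) e)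
  m∣a∸n (inj₂ a≤n) = subst (m ∣_) (sym (m≤n⇒m∸n≡0 a≤n)) (m ∣0)

∣! : ∀ {d n} → 0 < d → d ≤ n → d ∣ n !
∣! {suc d} _ d≤n = ∣-trans (m∣m*n (d !)) (m≤n⇒m!∣n! d≤n)

-- For T = B! and c = T² − 1, the numbers (c − i) / (i + 1) = T² / (i + 1) − 1 with i < n ≤ B are
-- pairwise coprime, have no prime factor ≤ B, and multiply up to (c choose n).
module Moduli (B : ℕ) (3≤B : 3 ≤ B) (c : ℕ) (c≡ : suc c ≡ B ! * B !) where
  T = B !

  factor : ℕ → ℕ
  factor i = T / suc i * T ∸ 1

  B≤T : B ≤ T
  B≤T = ∣⇒≤ {{B !≢0}} (∣! (≤-trans (s≤s z≤n) 3≤B) ≤-refl)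

  module _ {i : ℕ} (i<B : i < B) where
    quotient* : T / suc i * suc i ≡ T
    quotient* = m/n*n≡m (∣! {suc i} (s≤s z≤n) i<B)

    T≤ : T ≤ T / suc i * T
    T≤ = m≤n*m T (T / suc i) {{>-nonZero (positive (T / suc i) quotient*)}}
      where
      positive : ∀ t → t * suc i ≡ T → 0 < t
      positive zero 0≡T = contradiction (subst (3 ≤_) (sym 0≡T) (≤-trans 3≤B B≤T)) λ ()
      positive (suc t) _ = s≤s z≤n

    suc-factor : suc (factor i) ≡ T / suc i * T
    suc-factor = m+[n∸m]≡n {1} (≤-trans (≤-trans (s≤s z≤n) 3≤B) (≤-trans B≤T T≤))

    -- This guarantees a prime divisor, and it is where 3 ≤ B enters.
    1<factor : 1 < factor i
    1<factor = ≤-pred (subst (3 ≤_) (sym suc-factor) (≤-trans 3≤B (≤-trans B≤T T≤)))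

    c≡i+ : c ≡ i + suc i * factor i
    c≡i+ = suc-injective (begin
      suc c                            ≡⟨ c≡ ⟩
      T * T                            ≡⟨ cong (_* T) (sym quotient*) ⟩
      T / suc i * suc i * T            ≡⟨ l (T / suc i) (suc i) T ⟩
      suc i * (T / suc i * T)          ≡⟨ cong (suc i *_) (sym suc-factor) ⟩
      suc i * suc (factor i)         ≡⟨ *-suc (suc i) (factor i) ⟩
      suc i + suc i * factor i       ∎)
      where
      open ≡-Reasoning
      l : ∀ t i T → t * i * T ≡ i * (t * T)
      l = solve-∀

    coprime-T : Coprime (factor i) T
    coprime-T {d} (d∣M , d∣T) = ∣1⇒≡1 (∣m+n∣m⇒∣n
      (subst (d ∣_) (trans (sym suc-factor) (+-comm 1 (factor i))) (∣n⇒∣m*n (T / suc i) d∣T)) d∣M)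

    prime-factor> : ∀ {p} → Prime p → p ∣ factor i → B < p
    prime-factor> {p} pr p∣M with p ≤? B
    ... | no p≰B = ≰⇒> p≰B
    ... | yes p≤B = contradiction
      (coprime-T (p∣M , ∣! (<-trans (s≤s z≤n) (1<prime pr)) p≤B)) (λ p≡1 → <⇒≢ (1<prime pr) (sym p≡1))

    c≋i : c ≋ i [ factor i ]
    c≋i = ≋-trans (≋-reflexive c≡i+) (+*m≋ i (suc i))

    -- Passing from the falling product to the binomial coefficient cancels (u + 1)!, a divisor of
    -- T, to which the modulus is coprime.
    residue⇒∣binom : ∀ {a z u} → suc u ≤ B → z ≤ u → a ≋ z [ factor i ] → factor i ∣ binom a (suc u)
    residue⇒∣binom {a} {z} {u} u<B z≤u e = coprime-divisor
      (λ (d∣M , d∣u!) → coprime-T (d∣M , ∣-trans d∣u! (m≤n⇒m!∣n! u<B)))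
      (subst (factor i ∣_) (sym (!*binom a (suc u))) (residue⇒∣falling a (suc u) (s≤s z≤u) e))

  -- Since c = i + (i + 1) M_i for every i, the numbers (i + 1) M_i and (j + 1) M_j differ by j - i.
  -- A common divisor of M_i and M_j divides j - i ≤ B, hence T.
  pairwise-coprime : ∀ {n} → n ≤ B → PairwiseCoprime factor n
  pairwise-coprime n≤B {i} {j} i<j j<n {d} (d∣Mi , d∣Mj) with m≤n⇒∃[o]m+o≡n (<⇒≤ i<j)
  ... | zero , refl = contradiction (subst (i <_) (+-identityʳ i) i<j) (<-irrefl refl)
  ... | suc e , refl = coprime-T i<B (d∣Mi , ∣-trans d∣e (∣! (s≤s z≤n) (≤-trans (m≤n+m (suc e) i) (<⇒≤ j<B))))
    where
    j<B = ≤-trans j<n n≤B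
    i<B = <-trans i<j j<B
    eq : suc i * factor i ≡ suc j * factor j + suc e
    eq = +-cancelˡ-≡ i _ _ (trans (sym (c≡i+ i<B)) (trans (c≡i+ j<B) (l i (suc e) (suc j * factor j))))
      where
      l : ∀ i e m → i + e + m ≡ i + (m + e)
      l = solve-∀
    d∣e : d ∣ suc e
    d∣e = ∣m+n∣m⇒∣n (subst (d ∣_) eq (∣n⇒∣m*n (suc i) d∣Mi)) (∣n⇒∣m*n (suc j) d∣Mj)

  binom≡prod : ∀ n → n ≤ B → binom c n ≡ prod factor n
  binom≡prod zero _ = refl
  binom≡prod (suc n) n<B = *-cancelˡ-≡ _ _ (suc n) (begin
    suc n * binom c (suc n)              ≡⟨ binom-step c n ⟩
    (c ∸ n) * binom c n                  ≡⟨ cong₂ _*_ c∸n (binom≡prod n (<⇒≤ n<B)) ⟩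
    suc n * factor n * prod factor n ≡⟨ l (suc n) (factor n) (prod factor n) ⟩
    suc n * (prod factor n * factor n) ∎)
    where
    open ≡-Reasoning
    l : ∀ a b c → a * b * c ≡ a * (c * b)
    l = solve-∀
    c∸n : c ∸ n ≡ suc n * factor n
    c∸n = trans (cong (_∸ n) (c≡i+ n<B)) (m+n∸m≡n n _)

-- Finite conjunctions and formulas with two blocks of variables

all-Fin : ∀ {k} m {S : Fin m → Vec ℕ k → Set} → (∀ j → Dio (S j)) → Dio (λ ν → ∀ j → S j ν)
all-Fin zero d = iff (λ _ _ ()) (λ _ _ → refl) (𝟘 ≐ 𝟘)
all-Fin (suc m) d = iff (λ { _ (h , hs) zero → h ; _ (h , hs) (suc j) → hs j })
  (λ _ h → h zero , λ j → h (suc j)) (d zero ∧ all-Fin m (λ j → d (suc j)))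

all-List : ∀ {k} {A : Set} (as : List A) {S : A → Vec ℕ k → Set} → (∀ a → Dio (S a)) →
           Dio (λ ν → All (λ a → S a ν) as)
all-List [] d = iff (λ _ _ → []) (λ _ _ → refl) (𝟘 ≐ 𝟘)
all-List (a ∷ as) d = iff (λ { _ (h , hs) → h ∷ hs }) (λ { _ (h ∷ hs) → h , hs }) (d a ∧ all-List as d)

-- The tuple to be packed has a length that is not a numeral; its unknowns form a block of their own
-- in front of the parameters.
Dio₂ : ∀ m {k} → (Vec ℕ m → Vec ℕ k → Set) → Set₁
Dio₂ m S = Dio (λ μ → S (take m μ) (drop m μ))

take-⧺ : ∀ {m k} (ys : Vec ℕ m) (ν : Vec ℕ k) → take m (ys ⧺ ν) ≡ ys
take-⧺ [] ν = refl
take-⧺ (y ∷ ys) ν = cong (y ∷_) (take-⧺ ys ν)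

drop-⧺ : ∀ {m k} (ys : Vec ℕ m) (ν : Vec ℕ k) → drop m (ys ⧺ ν) ≡ ν
drop-⧺ [] ν = refl
drop-⧺ (y ∷ ys) ν = drop-⧺ ys ν

ex-block : ∀ m {k} {S : Vec ℕ (m + k) → Set} → Dio S → Dio (λ ν → ∃ λ (ys : Vec ℕ m) → S (ys ⧺ ν))
ex-block zero d = iff (λ _ h → [] , h) (λ { _ ([] , h) → h }) d
ex-block (suc m) d = iff (λ { _ (ys , y , h) → y ∷ ys , h }) (λ { _ (y ∷ ys , h) → ys , y , h })
  (ex-block m (ex d))

ex₂ : ∀ m {k} {S : Vec ℕ m → Vec ℕ k → Set} → Dio₂ m S → Dio (λ ν → ∃ λ ys → S ys ν)
ex₂ m {S = S} d = iff
  (λ { ν (ys , h) → ys , subst₂ S (take-⧺ ys ν) (drop-⧺ ys ν) h })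
  (λ { ν (ys , h) → ys , subst₂ S (sym (take-⧺ ys ν)) (sym (drop-⧺ ys ν)) h })
  (ex-block m d)

lookup-↑ˡ : ∀ m {k} (μ : Vec ℕ (m + k)) j → lookup μ (j ↑ˡ k) ≡ lookup (take m μ) j
lookup-↑ˡ m {k} μ j = trans (cong (λ z → lookup z (j ↑ˡ k)) (sym (take++drop≡id m μ)))
  (lookup-++ˡ (take m μ) (drop m μ) j)

lookup-↑ʳ : ∀ m {k} (μ : Vec ℕ (m + k)) i → lookup μ (m ↑ʳ i) ≡ lookup (drop m μ) i
lookup-↑ʳ m μ i = trans (cong (λ z → lookup z (m ↑ʳ i)) (sym (take++drop≡id m μ)))
  (lookup-++ʳ (take m μ) (drop m μ) i)

call₂ : ∀ {m k r} {S : Vec ℕ r → Set} → Dio S → (σ : Vec (Fin m ⊎ Fin k) r) →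
        Dio₂ m {k} (λ ys ν → S (map [ lookup ys , lookup ν ]′ σ))
call₂ {m} {k} {r} {S} d σ = iff
  (λ μ → subst S (eq μ)) (λ μ → subst S (sym (eq μ)))
  (call d (map (λ i → var (position i)) σ))
  where
  position : Fin m ⊎ Fin k → Fin (m + k)
  position (inj₁ j) = j ↑ˡ k
  position (inj₂ i) = m ↑ʳ i
  lookup-position : ∀ μ i → lookup μ (position i) ≡ [ lookup (take m μ) , lookup (drop m μ) ]′ i
  lookup-position μ (inj₁ j) = lookup-↑ˡ m μ j
  lookup-position μ (inj₂ i) = lookup-↑ʳ m μ i
  eq : ∀ μ → map (λ t → ⟦ t ⟧ μ) (map (λ i → var (position i)) σ)
           ≡ map [ lookup (take m μ) , lookup (drop m μ) ]′ σ
  eq μ = trans (sym (map-∘ _ _ σ)) (map-cong (lookup-position μ) σ)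

SatMod : ∀ {K} → ℕ → (Fin K → ℕ) → Equation K → Set
SatMod N a (one i) = a i ≋ 1 [ N ]
SatMod N a (add i j k) = a i + a j ≋ a k [ N ]
SatMod N a (mul i j k) = a i * a j ≋ a k [ N ]

-- Chosen to be at least 3 and n, as the moduli require, and to exceed u, 2u and u², so that sums
-- and products of entries up to u stay below every prime larger than it.
height : ℕ → ℕ → ℕ
height n u = 3 + (n + (u + u + u * u))

n≤height : ∀ n u → n ≤ height n u
n≤height n u = ≤-trans (m≤m+n n _) (m≤n+m _ 3)

u<height : ∀ n u → u < height n u
u<height n u = s≤s (≤-trans (≤-trans (m≤m+n u u) (m≤m+n _ _)) (≤-trans (m≤n+m _ n) (m≤n+m _ 2)))

2u<height : ∀ n u → u + u < height n u
2u<height n u = s≤s (≤-trans (m≤m+n (u + u) _) (≤-trans (m≤n+m _ n) (m≤n+m _ 2)))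

u²<height : ∀ n u → u * u < height n u
u²<height n u = s≤s (≤-trans (m≤n+m (u * u) (u + u)) (≤-trans (m≤n+m _ n) (m≤n+m _ 2)))

sum-Fin : ∀ {m} → (Fin m → ℕ) → ℕ
sum-Fin {zero} f = 0
sum-Fin {suc m} f = f zero + sum-Fin (λ j → f (suc j))

≤sum-Fin : ∀ {m} (f : Fin m → ℕ) j → f j ≤ sum-Fin f
≤sum-Fin f zero = m≤m+n _ _
≤sum-Fin f (suc j) = ≤-trans (≤sum-Fin (λ j → f (suc j)) j) (m≤n+m _ (f zero))

-- Elimination of a bounded universal quantifier

module Bounded {k} {Q : Vec ℕ (suc k) → Set} (normal : Normal Q) where
  open Normal normal

  K : ℕ
  K = suc k + aux

  -- The number a_j packs the values of unknown j for all i < n. Divisibility of (a_j choose u + 1)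
  -- by N keeps its residues at most u. The index i is packed by c, and each parameter, being the
  -- same for all i, by itself.
  Body : Vec ℕ K → Vec ℕ (5 + k) → Set
  Body ys ν =
      T ≡ (height n u) !
    × suc c ≡ T * T
    × N ≡ binom c n
    × (∀ j → N ∣ binom (a j) (suc u))
    × a (zero ↑ˡ aux) ≋ c [ N ]
    × (∀ s → a (suc s ↑ˡ aux) ≋ x s [ N ])
    × (∀ s → x s ≤ u)
    × All (SatMod N a) system
    where
    N = ν ! index 0
    c = ν ! index 1
    T = ν ! index 2
    u = ν ! index 3
    n = ν ! index 4
    a = lookup ys
    x : Fin k → ℕ
    x s = lookup ν (suc (suc (suc (suc (suc s)))))

  -- For each i one prime divisor p of the i-th modulus suffices: the residues modulo p form the
  -- solution, and all numbers compared lie below p, so congruences become equations.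
  body-sound : ∀ n xs → (∃ λ u → ∃ λ T → ∃ λ c → ∃ λ N → ∃ λ ys → Body ys (N ∷ c ∷ T ∷ u ∷ n ∷ xs)) →
               ∀ i → i < n → Q (i ∷ xs)
  body-sound n xs (u , T , c , N , ys , refl , c≡ , refl , N∣ , a₀≋c , aₛ≋x , x≤u , sat) i i<n =
    subst Q (cong₂ _∷_ z₀≡i (trans (tabulate-cong zₛ≡x) (tabulate∘lookup xs)))
      (solution⇒ z (solves sat))
    where
    a = lookup ys
    B = height n u
    open Moduli B (s≤s (s≤s (s≤s z≤n))) c c≡
    i<B : i < B
    i<B = ≤-trans i<n (n≤height n u)
    divisor = prime-divisor (factor i) (1<factor i<B)
    p = proj₁ divisor
    p-prime = proj₁ (proj₂ divisor)
    p∣M : p ∣ factor i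
    p∣M = proj₂ (proj₂ divisor)
    B<p : B < p
    B<p = prime-factor> i<B p-prime p∣M
    p∣N : p ∣ N
    p∣N = subst (p ∣_) (sym (binom≡prod n (n≤height n u))) (∣-trans p∣M (∣prod factor i<n))
    residue : ∀ j → ∃ λ z → z < suc u × a j ≋ z [ p ]
    residue j = ∣falling⇒residue p-prime (a j) (suc u)
      (subst (p ∣_) (!*binom (a j) (suc u)) (∣n⇒∣m*n (suc u !) (∣-trans p∣N (N∣ j))))
    z : Fin K → ℕ
    z j = proj₁ (residue j)
    z≤u : ∀ j → z j ≤ u
    z≤u j = ≤-pred (proj₁ (proj₂ (residue j)))
    a≋z : ∀ j → a j ≋ z j [ p ]
    a≋z j = proj₂ (proj₂ (residue j))
    z<p : ∀ j → z j < p
    z<p j = ≤-<-trans (z≤u j) (<-trans (u<height n u) B<p)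
    z₀≡i : z (zero ↑ˡ aux) ≡ i
    z₀≡i = ≋⇒≡ (z<p _) (<-trans i<B B<p)
      (≋-trans (≋-sym (a≋z _)) (≋-trans (≋-∣ p∣N a₀≋c) (≋-∣ p∣M (c≋i i<B))))
    zₛ≡x : ∀ s → z (suc s ↑ˡ aux) ≡ lookup xs s
    zₛ≡x s = ≋⇒≡ (z<p _) (≤-<-trans (x≤u s) (<-trans (u<height n u) B<p))
      (≋-trans (≋-sym (a≋z _)) (≋-∣ p∣N (aₛ≋x s)))
    satisfies : ∀ e → SatMod N a e → Sat z e
    satisfies (one i) h = ≋⇒≡ (z<p i) (1<prime p-prime) (≋-trans (≋-sym (a≋z i)) (≋-∣ p∣N h))
    satisfies (add i j l) h = ≋⇒≡
      (≤-<-trans (+-mono-≤ (z≤u i) (z≤u j)) (<-trans (2u<height n u) B<p)) (z<p l)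
      (≋-trans (≋-sym (≋-+ (a≋z i) (a≋z j))) (≋-trans (≋-∣ p∣N h) (a≋z l)))
    satisfies (mul i j l) h = ≋⇒≡
      (≤-<-trans (*-mono-≤ (z≤u i) (z≤u j)) (<-trans (u²<height n u) B<p)) (z<p l)
      (≋-trans (≋-sym (≋-* (a≋z i) (a≋z j))) (≋-trans (≋-∣ p∣N h) (a≋z l)))
    solves : ∀ {es} → All (SatMod N a) es → All (Sat z) es
    solves = mapAll (λ {e} → satisfies e)

  body-complete : ∀ n xs → (∀ i → i < n → Q (i ∷ xs)) →
                  ∃ λ u → ∃ λ T → ∃ λ c → ∃ λ N → ∃ λ ys → Body ys (N ∷ c ∷ T ∷ u ∷ n ∷ xs)
  body-complete n xs h = u , T , c , N , ys , refl , c≡ , refl ,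
    (λ j → subst (_∣ binom (a j) (suc u)) (sym N≡)
      (prod-∣ factor n coprime (λ i<n → residue⇒∣binom (i<B i<n) (u<height n u) (sol≤u i<n j) (a≋ i<n j)))) ,
    combine (λ i<n → ≋-trans (a≋ i<n _)
      (≋-trans (≋-reflexive (sol-zero i<n)) (≋-sym (c≋i (i<B i<n))))) ,
    (λ s → combine (λ i<n → ≋-trans (a≋ i<n _) (≋-reflexive (sol-suc i<n s)))) ,
    (λ s → ≤-trans (≤sum-Fin (lookup xs) s) (m≤m+n _ _)) ,
    all-sat system (λ i<n → sol-solves i<n)
    where
    solution : ∀ i → i < n → ∃ λ x → (∀ s → x (s ↑ˡ aux) ≡ lookup (i ∷ xs) s) × Solves x system
    solution i i<n = ⇒solution (i ∷ xs) (h i i<n)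
    -- Solutions are given only for i < n, while `bound` and `CRT` take total sequences; the value 0
    -- beyond n is arbitrary.
    sol : ℕ → Fin K → ℕ
    sol i with i <? n
    ... | yes i<n = proj₁ (solution i i<n)
    ... | no _ = λ _ → 0
    sol-spec : ∀ {i} → i < n → (∀ s → sol i (s ↑ˡ aux) ≡ lookup (i ∷ xs) s) × Solves (sol i) system
    sol-spec {i} i<n with i <? n
    ... | yes i<n′ = proj₂ (solution i i<n′)
    ... | no i≮n = contradiction i<n i≮n
    sol-zero : ∀ {i} → i < n → sol i (zero ↑ˡ aux) ≡ i
    sol-zero i<n = proj₁ (sol-spec i<n) zero
    sol-suc : ∀ {i} → i < n → ∀ s → sol i (suc s ↑ˡ aux) ≡ lookup xs s
    sol-suc i<n s = proj₁ (sol-spec i<n) (suc s)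
    sol-solves : ∀ {i} → i < n → Solves (sol i) system
    sol-solves i<n = proj₂ (sol-spec i<n)
    -- Sums stand in for maxima: u bounds every parameter and every entry of every solution.
    u = sum-Fin (lookup xs) + bound (λ i → sum-Fin (sol i)) n
    sol≤u : ∀ {i} → i < n → ∀ j → sol i j ≤ u
    sol≤u {i} i<n j = ≤-trans (≤sum-Fin (sol i) j)
      (≤-trans (≤bound (λ i → sum-Fin (sol i)) i<n) (m≤n+m _ (sum-Fin (lookup xs))))
    B = height n u
    T = B !
    c = T * T ∸ 1
    c≡ : suc c ≡ T * T
    c≡ = m+[n∸m]≡n {1} (*-mono-≤ {1} {T} {1} {T} 0<T 0<T)
      where
      0<T : 0 < T
      0<T = n≢0⇒n>0 (λ T≡0 → ≢-nonZero⁻¹ T {{B !≢0}} T≡0)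
    N = binom c n
    open Moduli B (s≤s (s≤s (s≤s z≤n))) c c≡ hiding (T)
    i<B : ∀ {i} → i < n → i < B
    i<B i<n = ≤-trans i<n (n≤height n u)
    coprime : PairwiseCoprime factor n
    coprime = pairwise-coprime (n≤height n u)
    N≡ : N ≡ prod factor n
    N≡ = binom≡prod n (n≤height n u)
    remainder : ∀ j → ∃ λ a → ∀ {i} → i < n → a ≋ sol i j [ factor i ]
    remainder j = CRT factor n coprime (λ i → sol i j)
    ys = tabulate (λ j → proj₁ (remainder j))
    a = lookup ys
    a≋ : ∀ {i} → i < n → ∀ j → a j ≋ sol i j [ factor i ]
    a≋ i<n j = ≋-trans (≋-reflexive (lookup∘tabulate (λ j → proj₁ (remainder j)) j)) (proj₂ (remainder j) i<n)
    combine : ∀ {p q} → (∀ {i} → i < n → p ≋ q [ factor i ]) → p ≋ q [ N ]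
    combine {p} {q} e = subst (p ≋ q [_]) (sym N≡) (≋-prod factor n coprime e)
    sat-mod : ∀ e → (∀ {i} → i < n → Sat (sol i) e) → SatMod N a e
    sat-mod (one i) h = combine (λ i<n → ≋-trans (a≋ i<n i) (≋-reflexive (h i<n)))
    sat-mod (add i j l) h = combine (λ i<n →
      ≋-trans (≋-+ (a≋ i<n i) (a≋ i<n j)) (≋-trans (≋-reflexive (h i<n)) (≋-sym (a≋ i<n l))))
    sat-mod (mul i j l) h = combine (λ i<n →
      ≋-trans (≋-* (a≋ i<n i) (a≋ i<n j)) (≋-trans (≋-reflexive (h i<n)) (≋-sym (a≋ i<n l))))
    all-sat : ∀ es → (∀ {i} → i < n → All (Sat (sol i)) es) → All (SatMod N a) es
    all-sat [] h = []
    all-sat (e ∷ es) h = sat-mod e (λ i<n → headAll (h i<n)) ∷ all-sat es (λ i<n → tailAll (h i<n))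

  SatMod-Dio : ∀ e → Dio₂ K {5 + k} (λ ys ν → SatMod (ν ! index 0) (lookup ys) e)
  SatMod-Dio (one i) = call₂ {S = λ ν → ν ! index 0 ≋ 1 [ ν ! index 1 ]}
    (cong-Dio (v 0) 𝟙 (v 1)) (inj₁ i ∷ inj₂ zero ∷ [])
  SatMod-Dio (add i j l) = call₂ {S = λ ν → ν ! index 0 + ν ! index 1 ≋ ν ! index 2 [ ν ! index 3 ]}
    (cong-Dio (v 0 ⊕ v 1) (v 2) (v 3)) (inj₁ i ∷ inj₁ j ∷ inj₁ l ∷ inj₂ zero ∷ [])
  SatMod-Dio (mul i j l) = call₂ {S = λ ν → ν ! index 0 * ν ! index 1 ≋ ν ! index 2 [ ν ! index 3 ]}
    (cong-Dio (v 0 ⊗ v 1) (v 2) (v 3)) (inj₁ i ∷ inj₁ j ∷ inj₁ l ∷ inj₂ zero ∷ [])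

  Body-Dio : Dio₂ K Body
  Body-Dio =
      call₂ {m = K} height!-Dio (inj₂ T ∷ inj₂ n ∷ inj₂ u ∷ [])
    ∧ call₂ {m = K} {S = λ ν → suc (ν ! index 0) ≡ ν ! index 1 * ν ! index 1} (𝟙 ⊕ v 0 ≐ v 1 ⊗ v 1) (inj₂ c ∷ inj₂ T ∷ [])
    ∧ call₂ {m = K} binom-Dio (inj₂ c ∷ inj₂ n ∷ inj₂ N ∷ [])
    ∧ all-Fin K (λ j → call₂ ∣binom-Dio (inj₂ N ∷ inj₁ j ∷ inj₂ u ∷ []))
    ∧ call₂ ≋-Dio (inj₁ (zero ↑ˡ aux) ∷ inj₂ c ∷ inj₂ N ∷ [])
    ∧ all-Fin k (λ s → call₂ ≋-Dio (inj₁ (suc s ↑ˡ aux) ∷ inj₂ (x s) ∷ inj₂ N ∷ []))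
    ∧ all-Fin k (λ s → call₂ {m = K} ≤-Dio (inj₂ (x s) ∷ inj₂ u ∷ []))
    ∧ all-List system SatMod-Dio
    where
    N c T u n : Fin (5 + k)
    N = index 0
    c = index 1
    T = index 2
    u = index 3
    n = index 4
    x : Fin k → Fin (5 + k)
    x s = suc (suc (suc (suc (suc s))))
    height!-Dio : Dio {3} λ ν → ν ! index 0 ≡ height (ν ! index 1) (ν ! index 2) !
    height!-Dio = call !-Dio (𝟙 ⊕ 𝟚 ⊕ (v 1 ⊕ (v 2 ⊕ v 2 ⊕ v 2 ⊗ v 2)) ∷ v 0 ∷ [])
    ∣binom-Dio : Dio {3} λ ν → ν ! index 0 ∣ binom (ν ! index 1) (suc (ν ! index 2))
    ∣binom-Dio = iff (λ { (N ∷ a ∷ u ∷ []) (b , q , refl , b≡) → divides q b≡ })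
      (λ { (N ∷ a ∷ u ∷ []) (divides q b≡) → binom a (suc u) , q , refl , b≡ })
      (ex (ex (call binom-Dio (v 3 ∷ 𝟙 ⊕ v 4 ∷ v 1 ∷ []) ∧ v 1 ≐ v 0 ⊗ v 2)))

  bounded-∀-Dio : Dio {suc k} λ ν → ∀ i → i < ν ! zero → Q (i ∷ tail ν)
  bounded-∀-Dio = iff (λ { (n ∷ xs) → body-sound n xs }) (λ { (n ∷ xs) → body-complete n xs })
    (ex (ex (ex (ex (ex₂ K {S = Body} Body-Dio)))))

bounded-∀ : ∀ {k} {Q : Vec ℕ (suc k) → Set} → Dio Q → Dio {suc k} λ ν → ∀ i → i < ν ! zero → Q (i ∷ tail ν)
bounded-∀ d = Bounded.bounded-∀-Dio (normalise d)

-- Graphs of codes are Diophantine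

eval-det : ∀ {k} {g : Code k} {xs y y′} → Eval g xs y → Eval g xs y′ → y ≡ y′
evalAll-det : ∀ {k m} {hs : Vec (Code k) m} {xs ys ys′} → EvalAll hs xs ys → EvalAll hs xs ys′ → ys ≡ ys′
mu-det : ∀ {k} {g : Code (suc k)} {xs i r r′} → MuFrom g xs i r → MuFrom g xs i r′ → r ≡ r′
eval-det ev-Z ev-Z = refl
eval-det ev-S ev-S = refl
eval-det ev-P ev-P = refl
eval-det (ev-C as e) (ev-C as′ e′) with evalAll-det as as′
... | refl = eval-det e e′
eval-det (ev-R0 e) (ev-R0 e′) = eval-det e e′
eval-det (ev-RS d e) (ev-RS d′ e′) with eval-det d d′
... | refl = eval-det e e′
eval-det (ev-M d) (ev-M d′) = mu-det d d′
evalAll-det ea-[] ea-[] = refl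
evalAll-det (ea-∷ e es) (ea-∷ e′ es′) = cong₂ _∷_ (eval-det e e′) (evalAll-det es es′)
mu-det (mu-stop e) (mu-stop e′) = refl
mu-det (mu-stop e) (mu-step e′ _) with eval-det e e′
... | ()
mu-det (mu-step e _) (mu-stop e′) with eval-det e e′
... | ()
mu-det (mu-step _ d) (mu-step _ d′) = mu-det d d′

-- `call` yields a `map` over terms, which does not reduce to a selection from an abstract vector;
-- here the two are identified entry by entry.
reindex : ∀ {k r} {S : Vec ℕ r → Set} → Dio S → (f : Vec ℕ k → Vec ℕ r) (σ : Fin r → Fin k) →
          (∀ ν i → lookup ν (σ i) ≡ lookup (f ν) i) → Dio (λ ν → S (f ν))
reindex {S = S} d f σ h = iff (λ ν → subst S (eq ν)) (λ ν → subst S (sym (eq ν)))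
  (call d (tabulate (λ i → var (σ i))))
  where
  eq : ∀ ν → map (λ t → ⟦ t ⟧ ν) (tabulate (λ i → var (σ i))) ≡ f ν
  eq ν = trans (sym (tabulate-∘ (λ t → ⟦ t ⟧ ν) (λ i → var (σ i))))
    (trans (tabulate-cong (h ν)) (tabulate∘lookup (f ν)))

lookup-tail : ∀ {k} (ν : Vec ℕ (suc k)) i → lookup ν (suc i) ≡ lookup (tail ν) i
lookup-tail (_ ∷ _) i = refl

-- The value comes first, so that it becomes x₁ of the final system and the argument becomes x₂.
Graph : ∀ {k} → Code k → Vec ℕ (suc k) → Set
Graph g ν = Eval g (tail ν) (lookup ν zero)

module _ {k} {g : Code (suc k)} {xs : Vec ℕ k} {r : ℕ} where
  mu-sound : Eval g (r ∷ xs) 0 → (∀ i → i < r → ∃ λ y → (∃ λ w → y ≡ suc w) × Eval g (i ∷ xs) y) →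
             Eval (M g) xs r
  mu-sound stop step = ev-M (from r 0 refl)
    where
    -- The search is rebuilt backwards, by recursion on the distance d from i to the result.
    from : ∀ d i → i + d ≡ r → MuFrom g xs i r
    from zero i e with trans (sym (+-identityʳ i)) e
    ... | refl = mu-stop stop
    from (suc d) i e with step i (subst (i <_) e (m<m+n i (s≤s z≤n)))
    ... | _ , (w , refl) , ev = mu-step ev (from d (suc i) (trans (sym (+-suc i d)) e))

  mu-complete : ∀ {i} → MuFrom g xs i r → Eval g (r ∷ xs) 0 ×
                (∀ j → i ≤ j → j < r → ∃ λ y → (∃ λ w → y ≡ suc w) × Eval g (j ∷ xs) y)
  mu-complete (mu-stop e) = e , λ j i≤j j<i → contradiction j<i (≤⇒≯ i≤j)
  mu-complete {i} (mu-step {v = w} e d) = proj₁ (mu-complete d) ,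
    λ j i≤j j<r → cases j (m≤n⇒m<n∨m≡n i≤j) j<r
    where
    cases : ∀ j → i < j ⊎ i ≡ j → j < r → ∃ λ y → (∃ λ w → y ≡ suc w) × Eval g (j ∷ xs) y
    cases j (inj₁ i<j) j<r = proj₂ (mu-complete d) j i<j j<r
    cases j (inj₂ refl) j<r = suc w , (w , refl) , e

module _ {k} {g : Code k} {h : Code (suc (suc k))} {xs : Vec ℕ k} where
  -- The whole history of a recursion is the digit sequence of one number s; a transition concerns
  -- two neighbouring digits.
  Step : ℕ → ℕ → ℕ → Set
  Step s q i = ∃ λ a → ∃ λ b → Digit s q i a × Digit s q (suc i) b × Eval h (i ∷ a ∷ xs) b

  rec-sound : ∀ {n y} s q → (∃ λ a → Digit s q 0 a × Eval g xs a) → (∀ i → i < n → Step s q i) →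
              Digit s q n y → Eval (R g h) (n ∷ xs) y
  rec-sound {n} {y} s q (a₀ , d₀ , e₀) step dₙ =
    let a , d , e = go n ≤-refl in subst (Eval (R g h) (n ∷ xs)) (digit-unique {i = n} d dₙ) e
    where
    go : ∀ i → i ≤ n → ∃ λ a → Digit s q i a × Eval (R g h) (i ∷ xs) a
    go zero _ = a₀ , d₀ , ev-R0 e₀
    go (suc i) i<n =
      let a , d , e = go i (<⇒≤ i<n)
          a′ , b , d′ , db , eb = step i i<n
      in b , db , ev-RS (subst (Eval (R g h) (i ∷ xs)) (digit-unique {i = i} d d′) e) eb

  -- The history is a function on all of ℕ, constrained only up to n; overwriting one argument
  -- extends it by a stage and keeps the earlier values.
  trace : ∀ {n y} → Eval (R g h) (n ∷ xs) y →
          ∃ λ f → Eval g xs (f 0) × (∀ i → i < n → Eval h (i ∷ f i ∷ xs) (f (suc i))) × f n ≡ y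
  trace {y = y} (ev-R0 e) = (λ _ → y) , e , (λ _ ()) , refl
  trace {suc n} {y} (ev-RS {r = r} d e) =
    let f , f0 , fs , fn = trace d
        f′ = update f (suc n) y
        old : ∀ {i} → i < suc n → f′ i ≡ f i
        old = update-agree f (suc n) y
        steps : ∀ i → i < suc n → Eval h (i ∷ f′ i ∷ xs) (f′ (suc i))
        steps i i<1+n = cases i i<1+n (m<1+n⇒m<n∨m≡n i<1+n) f fs fn
    in f′ , subst (Eval g xs) (sym (old (s≤s z≤n))) f0 , steps , update-same f (suc n) y
    where
    cases : ∀ i → i < suc n → i < n ⊎ i ≡ n → (f : ℕ → ℕ) →
            (∀ i → i < n → Eval h (i ∷ f i ∷ xs) (f (suc i))) → f n ≡ r →
            Eval h (i ∷ update f (suc n) y i ∷ xs) (update f (suc n) y (suc i))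
    cases i i<1+n (inj₁ i<n) f fs fn =
      subst₂ (λ a b → Eval h (i ∷ a ∷ xs) b)
        (sym (update-agree f (suc n) y i<1+n)) (sym (update-agree f (suc n) y (s≤s i<n))) (fs i i<n)
    cases i i<1+n (inj₂ refl) f fs fn =
      subst₂ (λ a b → Eval h (i ∷ a ∷ xs) b)
        (sym (trans (update-agree f (suc n) y i<1+n) fn)) (sym (update-same f (suc n) y)) e

  rec-complete : ∀ {n y} → Eval (R g h) (n ∷ xs) y → ∃ λ s → ∃ λ q →
                 (∃ λ a → Digit s q 0 a × Eval g xs a) × (∀ i → i < n → Step s q i) × Digit s q n y
  rec-complete {n} {y} e =
    let f , f0 , fs , fn = trace e
        q , s , ds = sequence-exists (suc n) f
    in s , q , (f 0 , ds (s≤s z≤n) , f0) ,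
       (λ i i<n → f i , f (suc i) , ds (m<n⇒m<1+n i<n) , ds (s≤s i<n) , fs i i<n) ,
       subst (Digit s q n) fn (ds (n<1+n n))

Eval-Dio : ∀ {k} (g : Code k) → Dio (Graph g)
EvalAll-Dio : ∀ {k m} (hs : Vec (Code k) m) → Dio₂ m {suc k} (λ ys ν → EvalAll hs (tail ν) ys)
Eval-Dio Z = iff (λ { (y ∷ xs) refl → ev-Z }) (λ { (y ∷ xs) ev-Z → refl }) (v 0 ≐ 𝟘)
Eval-Dio Sc = iff (λ { (y ∷ x ∷ []) refl → ev-S }) (λ { (y ∷ x ∷ []) ev-S → refl }) (v 0 ≐ 𝟙 ⊕ v 1)
Eval-Dio (P i) = iff (λ { (y ∷ xs) refl → ev-P }) (λ { (y ∷ xs) ev-P → refl }) (v 0 ≐ var (suc i))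
Eval-Dio {k} (C {m = m} g hs) = iff
  (λ { (y ∷ xs) (ys , es , e) → ev-C es e }) (λ { (y ∷ xs) (ev-C es e) → _ , es , e })
  (ex₂ m {S = λ ys ν → EvalAll hs (tail ν) ys × Eval g ys (lookup ν zero)}
    (EvalAll-Dio hs ∧
     reindex (Eval-Dio g) (λ μ → lookup (drop m μ) zero ∷ take m μ)
       (λ { zero → m ↑ʳ zero ; (suc j) → j ↑ˡ suc k })
       (λ { μ zero → lookup-↑ʳ m μ zero ; μ (suc j) → lookup-↑ˡ m μ j })))
Eval-Dio {suc k} (R g h) = iff
  (λ { (y ∷ n ∷ xs) (s , q , base , step , last) → rec-sound s q base step last })
  (λ { (y ∷ n ∷ xs) e → rec-complete e })
  (ex (ex
    ( ex (call Digit-Dio (v 2 ∷ v 1 ∷ 𝟘 ∷ v 0 ∷ []) ∧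
          reindex (Eval-Dio g) (λ μ → lookup μ zero ∷ tail (tail (tail (tail (tail μ)))))
            (λ { zero → zero ; (suc i) → suc (suc (suc (suc (suc i)))) })
            (λ { (_ ∷ _ ∷ _ ∷ _ ∷ _ ∷ _) zero → refl ; (_ ∷ _ ∷ _ ∷ _ ∷ _ ∷ _) (suc i) → refl }))
    -- `bounded-∀` reads its bound from the head of the context, so q, s, y, n, xs is rearranged to
    -- n, q, s, xs.
    ∧ reindex (bounded-∀ step-Dio)
        (λ μ → μ ! index 3 ∷ μ ! index 0 ∷ μ ! index 1 ∷ tail (tail (tail (tail μ))))
        (λ { zero → index 3 ; (suc zero) → index 0 ; (suc (suc zero)) → index 1
           ; (suc (suc (suc i))) → suc (suc (suc (suc i))) })
        (λ { μ zero → refl ; μ (suc zero) → refl ; μ (suc (suc zero)) → refl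
           ; (_ ∷ _ ∷ _ ∷ _ ∷ _) (suc (suc (suc i))) → refl })
    ∧ call Digit-Dio (v 1 ∷ v 0 ∷ v 3 ∷ v 2 ∷ []))))
  where
  step-Dio : Dio {3 + k} λ ν → Step {g = g} {h} {tail (tail (tail ν))} (ν ! index 2) (ν ! index 1) (ν ! index 0)
  step-Dio = ex (ex
    ( call Digit-Dio (v 4 ∷ v 3 ∷ v 2 ∷ v 1 ∷ [])
    ∧ call Digit-Dio (v 4 ∷ v 3 ∷ 𝟙 ⊕ v 2 ∷ v 0 ∷ [])
    ∧ reindex (Eval-Dio h)
        (λ μ → μ ! index 0 ∷ μ ! index 2 ∷ μ ! index 1 ∷ tail (tail (tail (tail (tail μ)))))
        (λ { zero → index 0 ; (suc zero) → index 2 ; (suc (suc zero)) → index 1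
           ; (suc (suc (suc i))) → suc (suc (suc (suc (suc i)))) })
        (λ { μ zero → refl ; μ (suc zero) → refl ; μ (suc (suc zero)) → refl
           ; (_ ∷ _ ∷ _ ∷ _ ∷ _ ∷ _) (suc (suc (suc i))) → refl })))
Eval-Dio (M g) = iff
  (λ { (r ∷ xs) ((_ , refl , stop) , step) → mu-sound stop step })
  (λ { (r ∷ xs) (ev-M d) → let stop , step = mu-complete d
                           in (0 , refl , stop) , λ i i<r → step i z≤n i<r })
  -- The result r already heads the context and serves as the bound. Asking each earlier argument
  -- for a value of the form 1 + w also excludes that the search diverges there.
  (ex (v 0 ≐ 𝟘 ∧ Eval-Dio g) ∧ bounded-∀ (ex (ex (v 1 ≐ 𝟙 ⊕ v 0) ∧ Eval-Dio g)))
EvalAll-Dio [] = iff (λ _ _ → ea-[]) (λ _ _ → refl) (𝟘 ≐ 𝟘)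
EvalAll-Dio {k} {suc m} (h ∷ hs) = iff
  (λ { (y ∷ μ) (e , es) → ea-∷ e es }) (λ { (y ∷ μ) (ea-∷ e es) → e , es })
  ( reindex (Eval-Dio h) (λ μ → lookup μ zero ∷ tail (drop (suc m) μ))
      (λ { zero → zero ; (suc i) → suc m ↑ʳ suc i })
      (λ { μ zero → refl
         ; μ (suc i) → trans (lookup-↑ʳ (suc m) μ (suc i)) (lookup-tail (drop (suc m) μ) i) })
  ∧ reindex (EvalAll-Dio hs) tail suc lookup-tail)

-- A system in exactly n variables

rename : ∀ {m n} → (Fin m → Fin n) → Equation m → Equation n
rename σ (one i) = one (σ i)
rename σ (add i j k) = add (σ i) (σ j) (σ k)
rename σ (mul i j k) = mul (σ i) (σ j) (σ k)

Sat-rename⁻ : ∀ {m n} (σ : Fin m → Fin n) x e → Sat x (rename σ e) → Sat (λ i → x (σ i)) e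
Sat-rename⁻ σ x (one i) h = h
Sat-rename⁻ σ x (add i j k) h = h
Sat-rename⁻ σ x (mul i j k) h = h

Sat-rename⁺ : ∀ {m n} (σ : Fin m → Fin n) x y → (∀ i → x (σ i) ≡ y i) → ∀ e → Sat y e → Sat x (rename σ e)
Sat-rename⁺ σ x y eq (one i) h = trans (eq i) h
Sat-rename⁺ σ x y eq (add i j k) h = trans (cong₂ _+_ (eq i) (eq j)) (trans h (sym (eq k)))
Sat-rename⁺ σ x y eq (mul i j k) h = trans (cong₂ _*_ (eq i) (eq j)) (trans h (sym (eq k)))

module Assembly (c : Code 1) (normal : Normal (Graph c)) where
  open Normal normal

  q : ℕ
  q = 2 + aux

  module _ (r : ℕ) where
    private
      -- The sum separates q variables for the flattened graph from q + r counters; `suc p` is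
      -- definitionally q + r, the value of the last counter.
      n p : ℕ
      n = q + (q + r)
      p = suc (aux + r)

    counter : Fin (q + r) → Fin n
    counter i = q ↑ʳ i

    output input : Fin n
    output = zero
    input = suc zero

    increment : Fin p → Equation n
    increment i = add (counter (inject₁ i)) (counter zero) (counter (suc i))

    counting : System n
    counting = one (counter zero) ∷ tabulateList increment

    -- The counters take the values 1, …, q + r, and n = (q + r) + q.
    full : System n
    full = mapList (rename (_↑ˡ (q + r))) system ++
           (add (counter (fromℕ p)) (counter (fromℕ (suc aux) ↑ˡ r)) input ∷ counting)

    -- The two summands are the values of the last counter and of the counter with index 1 + aux,
    -- which holds q and is present for every r.
    n≡ : suc p + suc (suc aux) ≡ n
    n≡ = +-comm (q + r) q

    counter-value : ∀ (x : Fin n → ℕ) → Solves x counting → ∀ i → x (counter i) ≡ suc (toℕ i)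
    counter-value x (first ∷ rest) = <-weakInduction (λ i → x (counter i) ≡ suc (toℕ i)) first
      (λ i ih → trans (sym (tabulate⁻ {f = increment} rest i))
        (trans (cong₂ _+_ (trans ih (cong suc (toℕ-inject₁ i))) first) (+-comm (suc (toℕ i)) 1)))

    full-sound : ∀ x → Solves x full → Eval c (n ∷ []) (x output)
    full-sound x h with ++⁻ʳ (mapList (rename (_↑ˡ (q + r))) system) h
    ... | inp ∷ cnt = subst (λ z → Eval c (z ∷ []) (x output)) input≡n
      (solution⇒ (λ i → x (i ↑ˡ (q + r)))
        (mapAll (λ {e} → Sat-rename⁻ (_↑ˡ (q + r)) x e)
          (map⁻ (++⁻ˡ (mapList (rename (_↑ˡ (q + r))) system) h))))
      where
      input≡n : x input ≡ n
      input≡n = trans (sym inp) (trans (cong₂ _+_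
        (trans (counter-value x cnt (fromℕ p)) (cong suc (toℕ-fromℕ p)))
        (trans (counter-value x cnt (fromℕ (suc aux) ↑ˡ r))
               (cong suc (trans (toℕ-↑ˡ (fromℕ (suc aux)) r) (toℕ-fromℕ (suc aux)))))) n≡)

    full-complete : ∀ {y} → Eval c (n ∷ []) y → Consistent full
    full-complete {y} e with ⇒solution (y ∷ n ∷ []) e
    ... | x , x≡ , solves = z , ++⁺
      (map⁺ (mapAll (λ {e} → Sat-rename⁺ (_↑ˡ (q + r)) z x z-↑ˡ e) solves))
      (trans (cong₂ _+_
        (trans (z-counter (fromℕ p)) (cong suc (toℕ-fromℕ p)))
        (trans (z-counter (fromℕ (suc aux) ↑ˡ r))
               (cong suc (trans (toℕ-↑ˡ (fromℕ (suc aux)) r) (toℕ-fromℕ (suc aux))))))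
        (trans n≡ (sym (trans (z-↑ˡ (suc zero)) (x≡ (suc zero)))))
      ∷ z-counter zero
      ∷ tabulate⁺ {f = increment} (λ i → trans (cong₂ _+_ (trans (z-counter (inject₁ i)) (cong suc (toℕ-inject₁ i))) (z-counter zero))
          (trans (+-comm (suc (toℕ i)) 1) (sym (z-counter (suc i))))))
      where
      z : Fin n → ℕ
      z i = [ x , (λ j → suc (toℕ j)) ]′ (splitAt q i)
      z-↑ˡ : ∀ i → z (i ↑ˡ (q + r)) ≡ x i
      z-↑ˡ i = cong [ x , (λ j → suc (toℕ j)) ]′ (splitAt-↑ˡ q i (q + r))
      z-counter : ∀ i → z (counter i) ≡ suc (toℕ i)
      z-counter i = cong [ x , (λ j → suc (toℕ j)) ]′ (splitAt-↑ʳ q (q + r) i)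

  threshold : ℕ
  threshold = q + q

  excess : ∀ {n} → threshold ≤ n → ∃ λ r → q + (q + r) ≡ n
  excess h = let r , e = m≤n⇒∃[o]m+o≡n h in r , trans (sym (+-assoc q q r)) e

  build : ∀ n → System n
  build n with threshold ≤? n
  ... | yes h = subst System (proj₂ (excess h)) (full (proj₁ (excess h)))
  -- Nothing is promised below the threshold; the empty system is an arbitrary default.
  ... | no _ = []

  build-correct : ∀ f → Computes c f → ∀ m → threshold ≤ suc m →
    Consistent (build (suc m)) × (∀ x → Solves x (build (suc m)) → x zero ≡ f (suc m))
  build-correct f computes m h with threshold ≤? suc m
  ... | no ≰ = contradiction h ≰
  ... | yes h′ = at (proj₁ (excess h′)) (proj₂ (excess h′))
    where
    -- With r and the equation generalised, matching on `refl` removes the transport.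
    at : ∀ r (e : q + (q + r) ≡ suc m) → let S = subst System e (full r) in
         Consistent S × (∀ x → Solves x S → x zero ≡ f (suc m))
    at r refl = full-complete r (computes (suc m)) ,
                λ x s → eval-det (full-sound r x s) (computes (suc m))

theorem2 : Σ (Code 1 → ℕ → Maybe ℕ) λ 𝒜 →
    Σ (Code 1 → (n : ℕ) → ℕ → Maybe (System n)) λ ℬ →
    ∀ (c : Code 1) (f : ℕ → ℕ) → Computes c f →
    Σ ℕ λ w → Returns (𝒜 c) w × 1 ≤ w ×
    (∀ (m : ℕ) → w ≤ suc m →
    Σ (System (suc m)) λ S → Returns (ℬ c (suc m)) S ×
    Consistent S ×
    (∀ (x : Fin (suc m) → ℕ) → Solves x S → x zero ≡ f (suc m)))
theorem2 =
  -- Both procedures answer at any fuel: the normal form comes from the syntax of c by total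
  -- functions, whether or not c computes a total function.
  (λ c _ → just (threshold c (normal c))) ,
  (λ c n _ → just (build c (normal c) n)) ,
  λ c f computes → threshold c (normal c) , returns _ , s≤s z≤n ,
    λ m h → build c (normal c) (suc m) , returns _ , build-correct c (normal c) f computes m h
  where
  open Assembly
  normal : ∀ c → Normal (Graph c)
  normal c = normalise (Eval-Dio c)
  returns : ∀ {A : Set} (a : A) → Returns (λ _ → just a) a
  returns a = (0 , refl) , λ { _ _ refl → refl }
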